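{- If $G$ is an HOH-free multisun, then $G$ satisfies the N-conditions.
   Context: Graphs are finite and simple. The diamond is $K_4$ minus an edge; diamond-free means no induced diamond. A hole is an induced cycle of length at least 4, odd if its length is odd. A multisun is a diamond-free graph of odd order whose maximal cliques of size 2 span a Hamiltonian cycle $C$ (the rim); all other maximal cliques consist of pairwise nonconsecutive vertices of $C$ and are the inscribed cliques. A sub-multisun is obtained by deleting the edge sets of some, but not all, inscribed cliques. A multisun is HOH-free if it and all its sub-multisuns have no odd hole. For inscribed cliques $A,B$ (possibly equal), an $AB$-path is a subpath of the rim with one endpoint in $A$, the other in $B$, and no internal vertex in any inscribed clique; an $A$-path is an $AA$-path; for $v\in B$ an $Av$-path is an $AB$-path whose endpoint in $B$ is $v$. The N-conditions are: (N1) every $A$-path has an even number of vertices, at least four; (N2) every inscribed clique has odd size; (N3) the inscribed cliques pairwise intersect in a common vertex $\xi$ of the rim and are otherwise pairwise disjoint; (N4) every $A\xi$-path has an even number of vertices; (N5) every $AB$-path with $A\ne B$ has an odd number of vertices.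
   Formalization: Condition (N5) is proved for AB-paths with both endpoints different from ξ; as literally written it fails whenever there are two inscribed cliques, since a path from ξ to a vertex of A is also an AB-path and has an even number of vertices. -}

module Defs where

open import Data.Nat using (ℕ; zero; suc; _≤_; _<_; _∸_; _%_)
open import Data.Nat.DivMod using (_mod_)
open import Data.Fin using (Fin; toℕ)
open import Data.Fin.Subset using (Subset; _∈_; _∉_; ∣_∣; ⁅_⁆; _∪_)
open import Data.Bool using (Bool; true; false)
open import Data.Product using (Σ; _×_)
open import Data.Sum using (_⊎_)
open import Data.Empty using (⊥)
open import Relation.Nullary using (¬_)
open import Relation.Binary.PropositionalEquality using (_≡_; _≢_)
open import Function.Definitions using (Injective)

record Graph (n : ℕ) : Set where
  field
    adj    : Fin n → Fin n → Bool
    sym    : ∀ u v → adj u v ≡ adj v u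
    irrefl : ∀ u → adj u u ≡ false

Rel : ℕ → Set₁
Rel n = Fin n → Fin n → Set

Adj : ∀ {n} → Graph n → Rel n
Adj G u v = Graph.adj G u v ≡ true

Odd : ℕ → Set
Odd m = m % 2 ≡ 1

Even : ℕ → Set
Even m = m % 2 ≡ 0

next : ∀ {k} → Fin k → Fin k
next {suc k} i = suc (toℕ i) mod suc k

step : ∀ {k} → ℕ → Fin k → Fin k
step zero    i = i
step (suc t) i = next (step t i)

CycAdj : ∀ {k} → Fin k → Fin k → Set
CycAdj i j = (next i ≡ j) ⊎ (next j ≡ i)

IsHole : ∀ {n} → Rel n → (k : ℕ) → (Fin k → Fin n) → Set
IsHole R k v =
  (4 ≤ k) × Injective _≡_ _≡_ v ×
  (∀ i j → i ≢ j → (R (v i) (v j) → CycAdj i j) × (CycAdj i j → R (v i) (v j)))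

HasOddHole : ∀ {n} → Rel n → Set
HasOddHole {n} R = Σ ℕ λ k → Odd k × Σ (Fin k → Fin n) λ v → IsHole R k v

DiamondFree : ∀ {n} → Graph n → Set
DiamondFree G = ∀ a b c d → a ≢ d →
  Adj G a b → Adj G a c → Adj G b c → Adj G b d → Adj G c d → ¬ Adj G a d → ⊥

IsClique : ∀ {n} → Graph n → Subset n → Set
IsClique G K = ∀ u v → u ∈ K → v ∈ K → u ≢ v → Adj G u v

IsMaxClique : ∀ {n} → Graph n → Subset n → Set
IsMaxClique G K = IsClique G K × (∀ w → w ∉ K → ¬ (∀ u → u ∈ K → Adj G w u))

-- Multisuns.  The rim (Hamiltonian cycle) is given by an injective
-- σ : Fin n → Fin n listing the vertices in cyclic order σ 0, σ 1, …

RimAdj : ∀ {n} → (Fin n → Fin n) → Fin n → Fin n → Set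
RimAdj {n} σ u v = Σ (Fin n) λ i → Σ (Fin n) λ j → σ i ≡ u × σ j ≡ v × CycAdj i j

record IsMultisun {n} (G : Graph n) (σ : Fin n → Fin n) : Set where
  field
    oddOrder    : Odd n
    atLeast3    : 3 ≤ n
    diamondFree : DiamondFree G
    σ-injective : Injective _≡_ _≡_ σ
    rimEdgesMax : ∀ u v → RimAdj σ u v → IsMaxClique G (⁅ u ⁆ ∪ ⁅ v ⁆)
    max2⇒rim    : ∀ K → IsMaxClique G K → ∣ K ∣ ≡ 2 →
                  ∀ u v → u ∈ K → v ∈ K → u ≢ v → RimAdj σ u v
    otherNonCons : ∀ K → IsMaxClique G K → ∣ K ∣ ≢ 2 →
                   ∀ u v → u ∈ K → v ∈ K → ¬ RimAdj σ u v

Inscribed : ∀ {n} → Graph n → Subset n → Set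
Inscribed G K = IsMaxClique G K × ∣ K ∣ ≢ 2

-- D selects a set of inscribed cliques whose edge sets are deleted:
-- at least one, but not all, inscribed cliques
IsDeletion : ∀ {n} → Graph n → (Subset n → Bool) → Set
IsDeletion {n} G D =
  (∀ K → D K ≡ true → Inscribed G K) ×
  (Σ (Subset n) λ K → D K ≡ true) ×
  (Σ (Subset n) λ K → Inscribed G K × D K ≡ false)

SubAdj : ∀ {n} → Graph n → (Subset n → Bool) → Rel n
SubAdj {n} G D u v =
  Adj G u v × ¬ (Σ (Subset n) λ K → D K ≡ true × u ∈ K × v ∈ K)

HOHFree : ∀ {n} → Graph n → Set
HOHFree G =
  ¬ HasOddHole (Adj G) ×
  (∀ D → IsDeletion G D → ¬ HasOddHole (SubAdj G D))

-- Subpaths of the rim: start at rim position i, m vertices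
-- σ i, σ (i+1), …, σ (i+m-1) (indices mod n), with 2 ≤ m ≤ n.

rv : ∀ {n} → (Fin n → Fin n) → Fin n → ℕ → Fin n
rv σ i t = σ (step t i)

NoInscribedInterior : ∀ {n} → Graph n → (Fin n → Fin n) → Fin n → ℕ → Set
NoInscribedInterior {n} G σ i m =
  ∀ t → 1 ≤ t → suc t < m → ∀ K → Inscribed G K → rv σ i t ∉ K

ABPath : ∀ {n} → Graph n → (Fin n → Fin n) → Subset n → Subset n → Fin n → ℕ → Set
ABPath {n} G σ A B i m =
  (2 ≤ m) × (m ≤ n) ×
  ((rv σ i 0 ∈ A × rv σ i (m ∸ 1) ∈ B) ⊎ (rv σ i 0 ∈ B × rv σ i (m ∸ 1) ∈ A)) ×
  NoInscribedInterior G σ i m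

AvPath : ∀ {n} → Graph n → (Fin n → Fin n) → Subset n → Fin n → Fin n → ℕ → Set
AvPath {n} G σ A v i m =
  (2 ≤ m) × (m ≤ n) ×
  ((rv σ i 0 ∈ A × rv σ i (m ∸ 1) ≡ v) ⊎ (rv σ i 0 ≡ v × rv σ i (m ∸ 1) ∈ A)) ×
  NoInscribedInterior G σ i m

N1 : ∀ {n} → Graph n → (Fin n → Fin n) → Set
N1 {n} G σ = ∀ A → Inscribed G A → ∀ (i : Fin n) m → ABPath G σ A A i m →
  Even m × 4 ≤ m

N2 : ∀ {n} → Graph n → Set
N2 G = ∀ A → Inscribed G A → Odd ∣ A ∣

N3 : ∀ {n} → Graph n → Fin n → Set
N3 G ξ =
  (∀ A → Inscribed G A → ξ ∈ A) ×
  (∀ A B → Inscribed G A → Inscribed G B → A ≢ B → ∀ v → v ∈ A → v ∈ B → v ≡ ξ)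

N4 : ∀ {n} → Graph n → (Fin n → Fin n) → Fin n → Set
N4 {n} G σ ξ = ∀ A → Inscribed G A → ∀ (i : Fin n) m → AvPath G σ A ξ i m → Even m

N5 : ∀ {n} → Graph n → (Fin n → Fin n) → Fin n → Set
N5 {n} G σ ξ = ∀ A B → Inscribed G A → Inscribed G B → A ≢ B →
  ∀ (i : Fin n) m → ABPath G σ A B i m →
  rv σ i 0 ≢ ξ → rv σ i (m ∸ 1) ≢ ξ → Odd m

NConditions : ∀ {n} → Graph n → (Fin n → Fin n) → Set
NConditions {n} G σ =
  N1 G σ × N2 G × (Σ (Fin n) λ ξ → N3 G ξ × N4 G σ ξ × N5 G σ ξ)

-- Fix inscribed cliques A and B (possibly equal) and delete the edges of all others.  Every chord of the
-- rim then lies in A or in B, so two disjoint rim intervals joined end to end by rim or clique edges form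
-- a hole as soon as no other pair of their vertices is in a common clique.
--
-- One interval between consecutive vertices of A, closed by their edge, shows that these vertices are at
-- odd distance.  Hence t + #(A before t) has constant parity on A, and going once around gives |A| odd.
--
-- Suppose A and B are disjoint.  Since |B| is odd, some gap s < e between consecutive vertices of A
-- contains an odd number of vertices of B; let b₁ and b₂ be the first and the last.  Then b₂ - b₁ is even,
-- so b₁ - s and e - b₂ have opposite parities, while two disjoint arcs between A and B have lengths of the
-- same parity (they close up to a hole).  This is absurd if b₁ ≠ b₂.  If b₁ = b₂ = b, let b′ and b″ be the
-- neighbours of b in the cyclic order of B, distinct by parity: an arc between e and b′ agrees with
-- [s, b], an arc between b″ and s + n agrees with [b, e], and these two arcs agree with each other.
--
-- So inscribed cliques meet pairwise, hence in a common ξ because there is no diamond; an arc from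
-- A to B avoiding ξ closes up through ξ, and therefore has even length.

module Submission where

open import Defs
open import Data.Bool using (Bool; true; false)
import Data.Bool.Properties as Bool
open import Data.Empty using (⊥; ⊥-elim)
open import Data.Fin as Fin using (Fin; zero; suc; toℕ; punchOut)
open import Data.Fin.Permutation using (Permutation; permutation)
open import Data.Fin.Properties
  using (toℕ-injective; toℕ<n; toℕ-fromℕ<; all?; any?; punchOut-injective; <⇒notInjective)
open import Data.Fin.Subset using (Subset; inside; outside; _∈_; _∉_; _⊆_; ∣_∣; ⁅_⁆; _∪_)
open import Data.Fin.Subset.Properties
  using (_∈?_; anySubset?; ⊆-antisym; p⊆p∪q; q⊆p∪q; x∈p∪q⁻; x∈⁅x⁆; x∈⁅y⁆⇒x≡y)
open import Data.Nat
  using (ℕ; zero; suc; _+_; _∸_; _≤_; _<_; _%_; z≤n; s≤s; s≤s⁻¹; z<s; _<?_; parity)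
open import Data.Nat.DivMod
  using (_mod_; m<n⇒m%n≡m; n%n≡0; m%n<n; [m+n]%n≡m%n; m%n%n≡m%n; %-distribˡ-+)
open import Data.Nat.Induction using (<-wellFounded)
open import Data.Nat.Properties
open import Data.Parity as ℙ using (Parity; 0ℙ; 1ℙ; _⁻¹)
import Data.Parity.Properties as ℙ
open import Data.Product using (∃; _×_; _,_; proj₁; proj₂)
open import Data.Sum using (_⊎_; inj₁; inj₂)
open import Data.Vec using ([]; _∷_; tabulate)
open import Data.Vec.Properties using (lookup∘tabulate; []=⇒lookup; lookup⇒[]=; ≡-dec)
open import Function using (_∘_)
open import Function.Definitions using (Injective)
open import Induction.WellFounded using (Acc; acc)
open import Level using (0ℓ)
open import Relation.Binary using (tri<; tri≈; tri>)
open import Relation.Binary.PropositionalEquality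
open import Relation.Nullary using (¬_; Dec; yes; no; contradiction; does)
open import Relation.Nullary.Decidable
  using (_×-dec_; _⊎-dec_; _→-dec_; ¬?; dec-true; dec-false; decidable-stable)
open import Relation.Unary using (Pred; Decidable)

open import Algebra.Properties.CommutativeMonoid.Sum ℙ.+-0-commutativeMonoid
  using (sum; sum-permute; sum-cong-≗)

-- Parities, and holes as cyclic sequences indexed by natural numbers

odd⇒parity : ∀ m → Odd m → parity m ≡ 1ℙ
odd⇒parity (suc zero)    _ = refl
odd⇒parity (suc (suc m)) o = odd⇒parity m o

parity⇒odd : ∀ m → parity m ≡ 1ℙ → Odd m
parity⇒odd (suc zero)    _ = refl
parity⇒odd (suc (suc m)) o = parity⇒odd m o

parity⇒even : ∀ m → parity m ≡ 0ℙ → Even m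
parity⇒even zero          _ = refl
parity⇒even (suc (suc m)) e = parity⇒even m e

-- Cyclic adjacency of positions `s` < `t` below `k` without modular arithmetic; the second
-- alternative is the closing pair of first and last position.
Link : ℕ → ℕ → ℕ → Set
Link k s t = t ≡ suc s ⊎ (s ≡ 0 × suc t ≡ k)

toℕ-next : ∀ {k} (i : Fin (suc k)) → toℕ (next i) ≡ suc (toℕ i) % suc k
toℕ-next i = toℕ-fromℕ< (m%n<n (suc (toℕ i)) _)

link⇒cycAdj : ∀ {k} (i j : Fin k) → Link k (toℕ i) (toℕ j) → CycAdj i j
link⇒cycAdj {suc k} i j (inj₁ j≡1+i) = inj₁ (toℕ-injective (begin
  toℕ (next i)        ≡⟨ toℕ-next i ⟩
  suc (toℕ i) % suc k ≡⟨ cong (_% suc k) j≡1+i ⟨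
  toℕ j % suc k       ≡⟨ m<n⇒m%n≡m (toℕ<n j) ⟩
  toℕ j               ∎))
  where open ≡-Reasoning
link⇒cycAdj {suc k} i j (inj₂ (i≡0 , 1+j≡k)) = inj₂ (toℕ-injective (begin
  toℕ (next j)        ≡⟨ toℕ-next j ⟩
  suc (toℕ j) % suc k ≡⟨ cong (_% suc k) 1+j≡k ⟩
  suc k % suc k       ≡⟨ n%n≡0 (suc k) ⟩
  0                   ≡⟨ i≡0 ⟨
  toℕ i               ∎))
  where open ≡-Reasoning

cycAdj⇒link : ∀ {k} (i j : Fin k) → toℕ i < toℕ j → CycAdj i j → Link k (toℕ i) (toℕ j)
cycAdj⇒link {suc k} i j i<j (inj₁ refl) =
  inj₁ (trans (toℕ-next i) (m<n⇒m%n≡m (≤-<-trans i<j (toℕ<n j))))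
cycAdj⇒link {suc k} i j i<j (inj₂ refl) with m≤n⇒m<n∨m≡n (toℕ<n j)
... | inj₁ 1+j<k = contradiction
  (<-trans (subst (_< toℕ j) (trans (toℕ-next j) (m<n⇒m%n≡m 1+j<k)) i<j) (n<1+n _)) (<-irrefl refl)
... | inj₂ 1+j≡k = inj₂ (trans (toℕ-next j) (trans (cong (_% suc k) 1+j≡k) (n%n≡0 (suc k))) , 1+j≡k)

-- Only ordered pairs of positions are constrained, since symmetry of `R` supplies the rest;
-- natural-number indices let sequences be concatenated without casts.
record Cycle {n} (R : Rel n) (k : ℕ) (v : ℕ → Fin n) : Set where
  field
    distinct : ∀ {s t} → s < t → t < k → v s ≢ v t
    induced  : ∀ {s t} → s < t → t < k → R (v s) (v t) → Link k s t
    edge     : ∀ {s t} → s < t → t < k → Link k s t → R (v s) (v t)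

record Path {n} (R : Rel n) (m : ℕ) (f : ℕ → Fin n) : Set where
  field
    distinct : ∀ {s t} → s < t → t < m → f s ≢ f t
    induced  : ∀ {s t} → s < t → t < m → R (f s) (f t) → t ≡ suc s
    edge     : ∀ {s} → suc s < m → R (f s) (f (suc s))

glue : ∀ {X : Set} → ℕ → (ℕ → X) → (ℕ → X) → ℕ → X
glue zero    f g t       = g t
glue (suc m) f g zero    = f zero
glue (suc m) f g (suc t) = glue m (f ∘ suc) g t

glue-left : ∀ {X : Set} m {f g : ℕ → X} {t} → t < m → glue m f g t ≡ f t
glue-left (suc m) {t = zero}  _   = refl
glue-left (suc m) {t = suc t} t<m = glue-left m (s≤s⁻¹ t<m)

glue-right : ∀ {X : Set} m {f g : ℕ → X} t → glue m f g (m + t) ≡ g t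
glue-right zero    t = refl
glue-right (suc m) t = glue-right m t

-- The two contacts allowed between paths with last positions `a` and `b`: the seam where the second
-- follows the first, and the pair of outer ends.
Ends : ℕ → ℕ → ℕ → ℕ → Set
Ends a b s t = (s ≡ a × t ≡ 0) ⊎ (s ≡ 0 × t ≡ b)

module _ {n} {R : Rel n} (R-sym : ∀ {u v} → R u v → R v u) where

  cycle⇒hole : ∀ {k v} → 4 ≤ k → Cycle R k v → IsHole R k (v ∘ toℕ)
  cycle⇒hole {k} {v} 4≤k C = 4≤k , inj , adj
    where
    open Cycle C
    inj : Injective _≡_ _≡_ (v ∘ toℕ)
    inj {i} {j} vi≡vj with <-cmp (toℕ i) (toℕ j)
    ... | tri< i<j _ _ = contradiction vi≡vj (distinct i<j (toℕ<n j))
    ... | tri≈ _ i≡j _ = toℕ-injective i≡j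
    ... | tri> _ _ j<i = contradiction (sym vi≡vj) (distinct j<i (toℕ<n i))
    swap : ∀ {i j : Fin k} → CycAdj i j → CycAdj j i
    swap (inj₁ p) = inj₂ p
    swap (inj₂ p) = inj₁ p
    adj : ∀ i j → i ≢ j → (R (v (toℕ i)) (v (toℕ j)) → CycAdj i j) ×
                          (CycAdj i j → R (v (toℕ i)) (v (toℕ j)))
    adj i j i≢j with <-cmp (toℕ i) (toℕ j)
    ... | tri< i<j _ _ = (λ r → link⇒cycAdj i j (induced i<j (toℕ<n j) r)) ,
                         (λ c → edge i<j (toℕ<n j) (cycAdj⇒link i j i<j c))
    ... | tri≈ _ i≡j _ = contradiction (toℕ-injective i≡j) i≢j
    ... | tri> _ _ j<i = (λ r → swap (link⇒cycAdj j i (induced j<i (toℕ<n i) (R-sym r)))) ,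
                         (λ c → R-sym (edge j<i (toℕ<n i) (cycAdj⇒link j i j<i (swap c))))

  reverse-path : ∀ {ℓ f} → Path R (suc ℓ) f → Path R (suc ℓ) (λ t → f (ℓ ∸ t))
  reverse-path {ℓ} {f} P = record
    { distinct = λ {s} s<t t<m e → distinct (flip s<t t<m) (s≤s (m∸n≤m ℓ s)) (sym e)
    ; induced  = λ {s} {t} s<t t<m r → ∸-cancelˡ-≡ (s≤s⁻¹ t<m) (≤-trans s<t (s≤s⁻¹ t<m)) (suc-injective (trans
        (sym (induced (flip s<t t<m) (s≤s (m∸n≤m ℓ s)) (R-sym r))) (+-∸-assoc 1 (≤-trans s<t (s≤s⁻¹ t<m)))))
    ; edge     = λ {s} 1+s<m → R-sym (subst (λ x → R (f (ℓ ∸ suc s)) (f x))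
        (sym (+-∸-assoc 1 (s≤s⁻¹ 1+s<m))) (edge (s≤s (subst (_≤ ℓ) (+-∸-assoc 1 (s≤s⁻¹ 1+s<m)) (m∸n≤m ℓ s)))))
    }
    where
    open Path P
    flip : ∀ {s t} → s < t → t < suc ℓ → ℓ ∸ t < ℓ ∸ s
    flip s<t t<m = ∸-monoʳ-< s<t (s≤s⁻¹ t<m)

  -- Two positions on the same path are governed by that path; for positions on different paths
  -- `cross` leaves only the two closing edges.
  glue-cycle : ∀ {a b f g} → Path R (suc a) f → Path R (suc b) g →
    (∀ {s t} → s ≤ a → t ≤ b → f s ≢ g t) →
    (∀ {s t} → s ≤ a → t ≤ b → R (f s) (g t) → Ends a b s t) →
    R (f a) (g 0) → R (f 0) (g b) → Cycle R (suc a + suc b) (glue (suc a) f g)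
  glue-cycle {a} {b} {f} {g} F G apart cross ab ba = record
    { distinct = λ s<t t<k → proj₁ (spec s<t t<k)
    ; induced = λ s<t t<k → proj₁ (proj₂ (spec s<t t<k))
    ; edge = λ s<t t<k → proj₂ (proj₂ (spec s<t t<k)) }
    where
    module F = Path F
    module G = Path G
    m k : ℕ
    m = suc a
    k = m + suc b
    v : ℕ → Fin n
    v = glue m f g

    Spec : ℕ → ℕ → Fin n → Fin n → Set
    Spec s t x y = x ≢ y × (R x y → Link k s t) × (Link k s t → R x y)

    end⇒link : ∀ {s t} → Ends a b s t → Link k s (m + t)
    end⇒link (inj₁ (refl , refl)) = inj₁ (cong suc (+-identityʳ a))
    end⇒link (inj₂ (refl , refl)) = inj₂ (refl , sym (+-suc m b))

    spec : ∀ {s t} → s < t → t < k → Spec s t (v s) (v t)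
    spec {s} {t} s<t t<k with t <? m | s <? m
    ... | yes t<m | _
      rewrite glue-left m {f} {g} t<m | glue-left m {f} {g} (<-trans s<t t<m) =
      F.distinct s<t t<m , (λ r → inj₁ (F.induced s<t t<m r)) , λ where
        (inj₁ refl)       → F.edge t<m
        (inj₂ (_ , 1+t≡k)) → contradiction (≤-<-trans t<m (m<m+n m z<s)) (<-irrefl 1+t≡k)
    ... | no t≮m | yes s<m with d , refl ← m≤n⇒∃[o]m+o≡n (≮⇒≥ t≮m)
      rewrite glue-left m {f} {g} s<m | glue-right m {f} {g} d =
      apart (s≤s⁻¹ s<m) d≤b , (λ r → end⇒link (cross (s≤s⁻¹ s<m) d≤b r)) , λ where
        (inj₁ e) → link₁ e
        (inj₂ (refl , e)) → subst (λ x → R (f 0) (g x)) (sym (suc-injective (+-cancelˡ-≡ m _ _ (trans (+-suc m d) e)))) ba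
      where
      d≤b : d ≤ b
      d≤b = s≤s⁻¹ (+-cancelˡ-< m _ _ t<k)
      link₁ : m + d ≡ suc s → R (f s) (g d)
      link₁ e with refl ← n≤0⇒n≡0 (+-cancelˡ-≤ m d 0 (≤-trans (≤-reflexive e) (subst (suc s ≤_) (sym (+-identityʳ m)) s<m))) =
        subst (λ x → R (f x) (g 0)) (suc-injective (trans (sym (+-identityʳ m)) e)) ab
    ... | no t≮m | no s≮m with c , refl ← m≤n⇒∃[o]m+o≡n (≮⇒≥ s≮m) | d , refl ← m≤n⇒∃[o]m+o≡n (≮⇒≥ t≮m)
      rewrite glue-right m {f} {g} c | glue-right m {f} {g} d =
      G.distinct c<d d<m , (λ r → inj₁ (trans (cong (m +_) (G.induced c<d d<m r)) (+-suc m c))) , λ where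
        (inj₁ e) → link₁ (+-cancelˡ-≡ m _ _ (trans e (sym (+-suc m c))))
        (inj₂ (() , _))
      where
      c<d : c < d
      c<d = +-cancelˡ-< m _ _ s<t
      d<m : d < suc b
      d<m = +-cancelˡ-< m _ _ t<k
      link₁ : d ≡ suc c → R (g c) (g d)
      link₁ refl = G.edge d<m

-- The rim

module _ {k : ℕ} where

  private
    n : ℕ
    n = suc k

  toℕ-mod : ∀ t → toℕ (t mod n) ≡ t % n
  toℕ-mod t = toℕ-fromℕ< (m%n<n t n)

  [m+d]%n : ∀ m d → (m + d) % n ≡ (m % n + d) % n
  [m+d]%n m d = begin
    (m + d) % n              ≡⟨ %-distribˡ-+ m d n ⟩
    (m % n + d % n) % n      ≡⟨ cong (λ x → (x + d % n) % n) (m%n%n≡m%n m n) ⟨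
    (m % n % n + d % n) % n  ≡⟨ %-distribˡ-+ (m % n) d n ⟨
    (m % n + d) % n          ∎
    where open ≡-Reasoning

  next-mod : ∀ t → next (t mod n) ≡ suc t mod n
  next-mod t = toℕ-injective (begin
    toℕ (next (t mod n))      ≡⟨ toℕ-next (t mod n) ⟩
    suc (toℕ (t mod n)) % n   ≡⟨ cong (λ x → suc x % n) (toℕ-mod t) ⟩
    suc (t % n) % n           ≡⟨ cong (_% n) (+-comm 1 (t % n)) ⟩
    (t % n + 1) % n           ≡⟨ [m+d]%n t 1 ⟨
    (t + 1) % n               ≡⟨ cong (_% n) (+-comm t 1) ⟩
    suc t % n                 ≡⟨ toℕ-mod (suc t) ⟨
    toℕ (suc t mod n)         ∎)
    where open ≡-Reasoning

  step-mod : ∀ t (i : Fin n) → step t i ≡ (toℕ i + t) mod n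
  step-mod zero    i = toℕ-injective (sym (begin
    toℕ ((toℕ i + 0) mod n)  ≡⟨ toℕ-mod (toℕ i + 0) ⟩
    (toℕ i + 0) % n          ≡⟨ cong (_% n) (+-identityʳ (toℕ i)) ⟩
    toℕ i % n                ≡⟨ m<n⇒m%n≡m (toℕ<n i) ⟩
    toℕ i                    ∎))
    where open ≡-Reasoning
  step-mod (suc t) i = begin
    next (step t i)              ≡⟨ cong next (step-mod t i) ⟩
    next ((toℕ i + t) mod n)     ≡⟨ next-mod (toℕ i + t) ⟩
    suc (toℕ i + t) mod n        ≡⟨ cong (_mod n) (+-suc (toℕ i) t) ⟨
    (toℕ i + suc t) mod n        ∎
    where open ≡-Reasoning

  -- Write `q` as `p + d` with `d` < `n`. If adding `d` to the residue of `p` does not wrap around,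
  -- then `d` is 0; if it does, equality of residues would force `d` to be `n`.
  %-unique : ∀ {p q} → p ≤ q → q < p + n → p % n ≡ q % n → p ≡ q
  %-unique {p} p≤q q<p+n e with d , refl ← m≤n⇒∃[o]m+o≡n p≤q
    with p % n + d <? n
  ... | yes a+d<n = sym (trans (cong (p +_) d≡0) (+-identityʳ p))
    where
    d≡0 : d ≡ 0
    d≡0 = +-cancelˡ-≡ (p % n) d 0
      (trans (sym (m<n⇒m%n≡m a+d<n)) (trans (sym ([m+d]%n p d)) (trans (sym e) (sym (+-identityʳ _)))))
  ... | no a+d≮n with c , n+c≡ ← m≤n⇒∃[o]m+o≡n (≮⇒≥ a+d≮n) =
    contradiction d≡n (<⇒≢ (+-cancelˡ-< p d n q<p+n))
    where
    c<n : c < n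
    c<n = +-cancelˡ-< n c n (subst (_< n + n) (sym n+c≡) (+-mono-< (m%n<n p n) (+-cancelˡ-< p d n q<p+n)))
    c≡a : c ≡ p % n
    c≡a = begin
      c                ≡⟨ m<n⇒m%n≡m c<n ⟨
      c % n            ≡⟨ [m+n]%n≡m%n c n ⟨
      (c + n) % n      ≡⟨ cong (_% n) (+-comm c n) ⟩
      (n + c) % n      ≡⟨ cong (_% n) n+c≡ ⟩
      (p % n + d) % n  ≡⟨ [m+d]%n p d ⟨
      (p + d) % n      ≡⟨ e ⟨
      p % n            ∎
      where open ≡-Reasoning
    d≡n : d ≡ n
    d≡n = +-cancelˡ-≡ (p % n) d n (trans (sym n+c≡) (trans (+-comm n c) (cong (_+ n) c≡a)))

-- Pigeonhole: punching out a missed value would inject a finite set into a smaller one.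
injective⇒onto : ∀ {n} {σ : Fin n → Fin n} → Injective _≡_ _≡_ σ → ∀ u → ∃ λ i → σ i ≡ u
injective⇒onto {suc n} {σ} inj u with any? (λ i → σ i Fin.≟ u)
... | yes hit = hit
... | no miss = contradiction
  (λ {i} {j} e → inj (punchOut-injective (λ p → miss (i , sym p)) (λ p → miss (j , sym p)) e))
  (<⇒notInjective (n<1+n n))

-- The rim unrolled: positions are natural numbers, read modulo the order.
module Rim {k : ℕ} (σ : Fin (suc k) → Fin (suc k)) (σ-inj : Injective _≡_ _≡_ σ) where

  private
    n : ℕ
    n = suc k

  V : ℕ → Fin n
  V t = σ (t mod n)

  V-unique : ∀ {p q} → p ≤ q → q < p + n → V p ≡ V q → p ≡ q
  V-unique {p} {q} p≤q q<p+n e = %-unique p≤q q<p+n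
    (trans (sym (toℕ-mod p)) (trans (cong toℕ (σ-inj e)) (toℕ-mod q)))

  V-distinct : ∀ {p q} → p < q → q < p + n → V p ≢ V q
  V-distinct p<q q<p+n e = <⇒≢ p<q (V-unique (<⇒≤ p<q) q<p+n e)

  V-periodic : ∀ t → V (t + n) ≡ V t
  V-periodic t = cong σ (toℕ-injective
    (trans (toℕ-mod (t + n)) (trans ([m+n]%n≡m%n t n) (sym (toℕ-mod t)))))

  V-toℕ : ∀ i → V (toℕ i) ≡ σ i
  V-toℕ i = cong σ (toℕ-injective (trans (toℕ-mod (toℕ i)) (m<n⇒m%n≡m (toℕ<n i))))

  rv≡V : ∀ i t → rv σ i t ≡ V (toℕ i + t)
  rv≡V i t = cong σ (step-mod t i)

  -- Sliding the window by one loses only position `s`, which returns as `s + n`.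
  V-onto : ∀ s u → ∃ λ p → s ≤ p × p < s + n × V p ≡ u
  V-onto zero u with i , refl ← injective⇒onto σ-inj u = toℕ i , z≤n , toℕ<n i , V-toℕ i
  V-onto (suc s) u with p , s≤p , p<s+n , e ← V-onto s u with m≤n⇒m<n∨m≡n s≤p
  ... | inj₁ s<p  = p , s<p , <-trans p<s+n (n<1+n _) , e
  ... | inj₂ refl = s + n , m<m+n s z<s , n<1+n _ , trans (V-periodic s) e

  rim-suc : ∀ p → RimAdj σ (V p) (V (suc p))
  rim-suc p = p mod n , suc p mod n , refl , refl , inj₁ (next-mod p)

  V-suc : ∀ {i j p q} → σ i ≡ V p → σ j ≡ V q → next i ≡ j → V (suc p) ≡ V q
  V-suc {p = p} σi σj ij = trans (cong σ (trans (sym (next-mod p)) (trans (cong next (sym (σ-inj σi))) ij))) σj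

  -- In the second alternative the successor of `q` is `p` one turn later.
  rim-link : ∀ {p q} → p < q → q < p + n → RimAdj σ (V p) (V q) → q ≡ suc p ⊎ suc q ≡ p + n
  rim-link {p} {q} p<q q<p+n (i , j , σi , σj , inj₁ ij) =
    inj₁ (sym (V-unique p<q (<-trans q<p+n (n<1+n _)) (V-suc {q = q} σi σj ij)))
  rim-link {p} {q} p<q q<p+n (i , j , σi , σj , inj₂ ji) =
    inj₂ (V-unique q<p+n (<-trans (+-monoˡ-< n p<q) (n<1+n _)) (trans (V-suc {q = p} σj σi ji) (sym (V-periodic p))))

  -- Holes made of one or two rim intervals

  module RimHoles (R L : Rel (suc k)) (R-sym : ∀ {u v} → R u v → R v u)
    (R-rim : ∀ p → R (V p) (V (suc p)))
    (R-inv : ∀ {u v} → R u v → RimAdj σ u v ⊎ L u v)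
    (noOddHole : ¬ HasOddHole R) where

    even-cycle : ∀ {m v} → 4 ≤ m → Cycle R m v → parity m ≡ 0ℙ
    even-cycle {m} {v} 4≤m C with parity m in eq
    ... | 0ℙ = refl
    ... | 1ℙ = contradiction (m , parity⇒odd m eq , _ , cycle⇒hole R-sym 4≤m C) noOddHole

    -- `L` stands for membership in a common kept clique, so inside a free interval only rim edges
    -- remain.
    Free : ℕ → ℕ → Set
    Free s ℓ = ∀ {x y} → x < y → y ≤ ℓ → ¬ L (V (s + x)) (V (s + y))

    -- The bound leaves a vertex outside the interval, so no rim edge joins its ends around the
    -- circle.
    rim-path : ∀ s {ℓ} → suc ℓ < n → Free s ℓ → Path R (suc ℓ) (λ x → V (s + x))
    rim-path s {ℓ} 1+ℓ<n free = record
      { distinct = λ x<y y<m → V-distinct (+-monoʳ-< s x<y) (near y<m)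
      ; induced  = ind
      ; edge     = λ {x} _ → subst (λ z → R (V (s + x)) (V z)) (sym (+-suc s x)) (R-rim (s + x))
      }
      where
      near : ∀ {x y} → y < suc ℓ → s + y < s + x + n
      near {x} {y} y<m = subst (s + y <_) (sym (+-assoc s x n))
        (+-monoʳ-< s (<-≤-trans (<-trans y<m 1+ℓ<n) (m≤n+m n x)))
      ind : ∀ {x y} → x < y → y < suc ℓ → R (V (s + x)) (V (s + y)) → y ≡ suc x
      ind {x} {y} x<y y<m r with R-inv r
      ... | inj₂ l = contradiction l (free x<y (s≤s⁻¹ y<m))
      ... | inj₁ rim with rim-link (+-monoʳ-< s x<y) (near {x} y<m) rim
      ...   | inj₁ e = +-cancelˡ-≡ s y (suc x) (trans e (sym (+-suc s x)))
      ...   | inj₂ e = contradiction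
        (≤-trans (≤-trans (m≤n+m n x) (≤-reflexive (+-cancelˡ-≡ s _ _
          (trans (sym (+-assoc s x n)) (trans (sym e) (sym (+-suc s y))))))) y<m)
        (<⇒≱ 1+ℓ<n)

    module TwoIntervals {s₁ ℓ₁ s₂ ℓ₂} (e₁<s₂ : s₁ + ℓ₁ < s₂) (e₂<s₁+n : s₂ + ℓ₂ < s₁ + n) where

      s₁<s₂ : s₁ < s₂
      s₁<s₂ = ≤-<-trans (m≤m+n s₁ ℓ₁) e₁<s₂

      short₁ : suc ℓ₁ < n
      short₁ = +-cancelˡ-< s₁ (suc ℓ₁) n (≤-<-trans
        (≤-trans (≤-reflexive (+-suc s₁ ℓ₁)) (≤-trans e₁<s₂ (m≤m+n s₂ ℓ₂))) e₂<s₁+n)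

      short₂ : suc ℓ₂ < n
      short₂ = +-cancelˡ-< s₂ (suc ℓ₂) n (≤-<-trans
        (≤-trans (≤-reflexive (+-suc s₂ ℓ₂)) e₂<s₁+n) (+-monoˡ-< n s₁<s₂))

      between : ∀ {x y} → x ≤ ℓ₁ → y ≤ ℓ₂ → s₁ + x < s₂ + y × s₂ + y < s₁ + x + n
      between {x} {y} x≤ℓ₁ y≤ℓ₂ =
        <-≤-trans (≤-<-trans (+-monoʳ-≤ s₁ x≤ℓ₁) e₁<s₂) (m≤m+n s₂ y) ,
        ≤-<-trans (+-monoʳ-≤ s₂ y≤ℓ₂) (<-≤-trans e₂<s₁+n (+-monoˡ-≤ n (m≤m+n s₁ x)))

      apart : ∀ {x y} → x ≤ ℓ₁ → y ≤ ℓ₂ → V (s₁ + x) ≢ V (s₂ + y)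
      apart x≤ y≤ = V-distinct (proj₁ (between x≤ y≤)) (proj₂ (between x≤ y≤))

      -- A rim edge between the intervals joins facing ends with no vertex between them. The
      -- equation recording this is what excludes such an edge when it would be a chord.
      cross : ∀ {x y} → x ≤ ℓ₁ → y ≤ ℓ₂ → R (V (s₁ + x)) (V (s₂ + y)) →
        (x ≡ ℓ₁ × y ≡ 0 × suc (s₁ + ℓ₁) ≡ s₂) ⊎ (x ≡ 0 × y ≡ ℓ₂ × suc (s₂ + ℓ₂) ≡ s₁ + n) ⊎
        L (V (s₁ + x)) (V (s₂ + y))
      cross {x} {y} x≤ y≤ r with R-inv r
      ... | inj₂ l = inj₂ (inj₂ l)
      ... | inj₁ rim with rim-link (proj₁ (between x≤ y≤)) (proj₂ (between x≤ y≤)) rim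
      ...   | inj₁ e = inj₁ (x≡ℓ₁ , y≡0 , trans (cong (λ z → suc (s₁ + z)) (sym x≡ℓ₁))
                                          (trans (sym e) (trans (cong (s₂ +_) y≡0) (+-identityʳ s₂))))
        where
        x≡ℓ₁ : x ≡ ℓ₁
        x≡ℓ₁ = ≤-antisym x≤ (+-cancelˡ-≤ s₁ ℓ₁ x (s≤s⁻¹ (≤-trans e₁<s₂ (≤-trans (m≤m+n s₂ y) (≤-reflexive e)))))
        y≡0 : y ≡ 0
        y≡0 = n≤0⇒n≡0 (+-cancelˡ-≤ s₂ y 0 (≤-trans (≤-reflexive e)
                (≤-trans (s≤s (+-monoʳ-≤ s₁ x≤)) (≤-trans e₁<s₂ (≤-reflexive (sym (+-identityʳ s₂)))))))
      ...   | inj₂ e = inj₂ (inj₁ (x≡0 , y≡ℓ₂ , trans (cong (λ z → suc (s₂ + z)) (sym y≡ℓ₂))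
                                          (trans e (cong (_+ n) (trans (cong (s₁ +_) x≡0) (+-identityʳ s₁))))))
        where
        tight : s₁ + x + n ≤ s₁ + n
        tight = ≤-trans (≤-reflexive (sym e)) (≤-trans (s≤s (+-monoʳ-≤ s₂ y≤)) e₂<s₁+n)
        x≡0 : x ≡ 0
        x≡0 = n≤0⇒n≡0 (+-cancelˡ-≤ s₁ x 0 (+-cancelʳ-≤ n _ _ (≤-trans tight (≤-reflexive (cong (_+ n) (sym (+-identityʳ s₁)))))))
        y≡ℓ₂ : y ≡ ℓ₂
        y≡ℓ₂ = ≤-antisym y≤ (+-cancelˡ-≤ s₂ ℓ₂ y (s≤s⁻¹ (≤-trans e₂<s₁+n
                 (≤-trans (+-monoˡ-≤ n (m≤m+n s₁ x)) (≤-reflexive (sym e))))))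

      -- Facing ends are joined here, so a rim edge between adjoining intervals is itself a closing
      -- edge of the cycle.
      even-parallel : 4 ≤ suc ℓ₁ + suc ℓ₂ → Free s₁ ℓ₁ → Free s₂ ℓ₂ →
        (∀ {x y} → x ≤ ℓ₁ → y ≤ ℓ₂ → L (V (s₁ + x)) (V (s₂ + y)) → Ends ℓ₁ ℓ₂ x y) →
        R (V (s₁ + ℓ₁)) (V (s₂ + 0)) → R (V (s₁ + 0)) (V (s₂ + ℓ₂)) →
        parity (suc ℓ₁ + suc ℓ₂) ≡ 0ℙ
      even-parallel 4≤ free₁ free₂ ends ab ba = even-cycle 4≤
        (glue-cycle R-sym (rim-path s₁ short₁ free₁) (rim-path s₂ short₂ free₂) apart only ab ba)
        where
        only : ∀ {x y} → x ≤ ℓ₁ → y ≤ ℓ₂ → R (V (s₁ + x)) (V (s₂ + y)) → Ends ℓ₁ ℓ₂ x y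
        only x≤ y≤ r with cross x≤ y≤ r
        ... | inj₁ (x≡ℓ₁ , y≡0 , _)        = inj₁ (x≡ℓ₁ , y≡0)
        ... | inj₂ (inj₁ (x≡0 , y≡ℓ₂ , _)) = inj₂ (x≡0 , y≡ℓ₂)
        ... | inj₂ (inj₂ l)                = ends x≤ y≤ l

      -- Starts are joined to starts and ends to ends, so the second interval is traversed
      -- backwards. A rim edge between facing ends could now be a chord; hence the intervals must
      -- not adjoin.
      even-crossed : 4 ≤ suc ℓ₁ + suc ℓ₂ → suc (s₁ + ℓ₁) ≢ s₂ → suc (s₂ + ℓ₂) ≢ s₁ + n →
        Free s₁ ℓ₁ → Free s₂ ℓ₂ →
        (∀ {x y} → x ≤ ℓ₁ → y ≤ ℓ₂ → L (V (s₁ + x)) (V (s₂ + y)) → Ends ℓ₁ ℓ₂ x (ℓ₂ ∸ y)) →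
        R (V (s₁ + ℓ₁)) (V (s₂ + ℓ₂)) → R (V (s₁ + 0)) (V (s₂ + 0)) →
        parity (suc ℓ₁ + suc ℓ₂) ≡ 0ℙ
      even-crossed 4≤ no-link₁ no-link₂ free₁ free₂ ends ab ba = even-cycle 4≤
        (glue-cycle R-sym (rim-path s₁ short₁ free₁) (reverse-path R-sym (rim-path s₂ short₂ free₂))
          (λ {_} {y} x≤ y≤ → apart x≤ (m∸n≤m ℓ₂ y)) only ab
          (subst (λ z → R (V (s₁ + 0)) (V (s₂ + z))) (sym (n∸n≡0 ℓ₂)) ba))
        where
        only : ∀ {x y} → x ≤ ℓ₁ → y ≤ ℓ₂ → R (V (s₁ + x)) (V (s₂ + (ℓ₂ ∸ y))) → Ends ℓ₁ ℓ₂ x y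
        only {x} {y} x≤ y≤ r with cross x≤ (m∸n≤m ℓ₂ y) r
        ... | inj₁ (_ , _ , e)        = contradiction e no-link₁
        ... | inj₂ (inj₁ (_ , _ , e)) = contradiction e no-link₂
        ... | inj₂ (inj₂ l)           = subst (Ends ℓ₁ ℓ₂ x) (m∸[m∸n]≡n y≤) (ends x≤ (m∸n≤m ℓ₂ y) l)

-- Maximal cliques of a diamond-free graph

does-true : ∀ {P : Set} (P? : Dec P) → does P? ≡ true → P
does-true (yes p) _ = p

_≟ˢ_ : ∀ {n} (A B : Subset n) → Dec (A ≡ B)
_≟ˢ_ = ≡-dec Bool._≟_

module _ {n} {P : Pred (Fin n) 0ℓ} (P? : Decidable P) where

  comprehension : Subset n
  comprehension = tabulate (does ∘ P?)

  ∈-comprehension⁺ : ∀ {u} → P u → u ∈ comprehension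
  ∈-comprehension⁺ {u} p = lookup⇒[]= u _ (trans (lookup∘tabulate (does ∘ P?) u) (dec-true (P? u) p))

  ∈-comprehension⁻ : ∀ {u} → u ∈ comprehension → P u
  ∈-comprehension⁻ {u} u∈ = does-true (P? u) (trans (sym (lookup∘tabulate (does ∘ P?) u)) ([]=⇒lookup u∈))

IsHole-cong : ∀ {n} {R R′ : Rel n} → (∀ {u v} → R u v → R′ u v) → (∀ {u v} → R′ u v → R u v) →
  ∀ {k v} → IsHole R k v → IsHole R′ k v
IsHole-cong to from (4≤k , inj , adj) =
  4≤k , inj , λ i j i≢j → proj₁ (adj i j i≢j) ∘ from , to ∘ proj₂ (adj i j i≢j)

module GraphFacts {n} (G : Graph n) where

  adj? : ∀ u v → Dec (Adj G u v)
  adj? u v = Graph.adj G u v Bool.≟ true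

  adj-sym : ∀ {u v} → Adj G u v → Adj G v u
  adj-sym {u} {v} = trans (Graph.sym G v u)

  adj⇒≢ : ∀ {u v} → Adj G u v → u ≢ v
  adj⇒≢ {u} uv refl = contradiction (trans (sym uv) (Graph.irrefl G u)) λ ()

  maxClique? : ∀ K → Dec (IsMaxClique G K)
  maxClique? K =
    all? (λ u → all? λ v → (u ∈? K) →-dec (v ∈? K) →-dec ¬? (u Fin.≟ v) →-dec adj? u v) ×-dec
    all? (λ w → ¬? (w ∈? K) →-dec ¬? (all? λ u → (u ∈? K) →-dec adj? w u))

  inscribed? : ∀ K → Dec (Inscribed G K)
  inscribed? K = maxClique? K ×-dec ¬? (∣ K ∣ ≟ 2)

  -- Any vertex of the graph extends the empty clique.
  maxClique-nonempty : ∀ {K} → Fin n → IsMaxClique G K → ∃ λ u → u ∈ K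
  maxClique-nonempty {K} w (_ , max) with any? (_∈? K)
  ... | yes hit = hit
  ... | no miss = contradiction (λ u u∈K → contradiction (u , u∈K) miss) (max w (miss ∘ (w ,_)))

  maxClique-other : ∀ {K u w} → IsMaxClique G K → u ∈ K → Adj G w u → w ∉ K → ∃ λ v → v ∈ K × v ≢ u
  maxClique-other {K} {u} {w} (_ , max) u∈K wu w∉K with any? (λ v → (v ∈? K) ×-dec ¬? (v Fin.≟ u))
  ... | yes hit = hit
  ... | no miss = contradiction all-adjacent (max w w∉K)
    where
    all-adjacent : ∀ v → v ∈ K → Adj G w v
    all-adjacent v v∈K with v Fin.≟ u
    ... | yes refl = wu
    ... | no v≢u   = contradiction (v , v∈K , v≢u) miss

  module _ (diamondFree : DiamondFree G) where

    common-neighbours-adjacent : ∀ {a b c d} → Adj G b c → a ≢ d →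
      Adj G a b → Adj G a c → Adj G d b → Adj G d c → Adj G a d
    common-neighbours-adjacent {a} {d = d} bc a≢d ab ac db dc =
      decidable-stable (adj? a d) (diamondFree a _ _ d a≢d ab ac bc (adj-sym db) (adj-sym dc))

    -- Every further vertex of `K` shares the adjacent neighbours `u` and `v` with `w`, so it is
    -- adjacent to `w` for want of a diamond; maximality does the rest.
    maxClique-absorbs : ∀ {K u v w} → IsMaxClique G K → u ∈ K → v ∈ K → u ≢ v →
      Adj G w u → Adj G w v → w ∈ K
    maxClique-absorbs {K} {u} {v} {w} (clique , max) u∈K v∈K u≢v wu wv with w ∈? K
    ... | yes w∈K = w∈K
    ... | no w∉K  = contradiction all-adjacent (max w w∉K)
      where
      all-adjacent : ∀ x → x ∈ K → Adj G w x
      all-adjacent x x∈K with x Fin.≟ u | x Fin.≟ v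
      ... | yes refl | _        = wu
      ... | no _     | yes refl = wv
      ... | no x≢u   | no x≢v   = common-neighbours-adjacent (clique u v u∈K v∈K u≢v)
        (λ { refl → w∉K x∈K }) wu wv (clique x u x∈K u∈K x≢u) (clique x v x∈K v∈K x≢v)

    maxClique-⊆ : ∀ {K K′ u v} → IsMaxClique G K → IsMaxClique G K′ → u ≢ v →
      u ∈ K → v ∈ K → u ∈ K′ → v ∈ K′ → K ⊆ K′
    maxClique-⊆ {u = u} {v} (clique , _) max′ u≢v u∈K v∈K u∈K′ v∈K′ {x} x∈K with x Fin.≟ u | x Fin.≟ v
    ... | yes refl | _        = u∈K′
    ... | no _     | yes refl = v∈K′
    ... | no x≢u   | no x≢v   = maxClique-absorbs max′ u∈K′ v∈K′ u≢v
      (clique x u x∈K u∈K x≢u) (clique x v x∈K v∈K x≢v)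

    maxClique-unique : ∀ {K K′ u v} → IsMaxClique G K → IsMaxClique G K′ → u ≢ v →
      u ∈ K → v ∈ K → u ∈ K′ → v ∈ K′ → K ≡ K′
    maxClique-unique max max′ u≢v u∈K v∈K u∈K′ v∈K′ =
      ⊆-antisym (maxClique-⊆ max max′ u≢v u∈K v∈K u∈K′ v∈K′) (maxClique-⊆ max′ max u≢v u∈K′ v∈K′ u∈K v∈K)

    -- The endpoints of an edge and their common neighbours form a clique, since there is no diamond.
    edge-maxClique : ∀ {u v} → Adj G u v → ∃ λ K → IsMaxClique G K × u ∈ K × v ∈ K
    edge-maxClique {u} {v} uv = K , (clique , max) , u∈K , v∈K
      where
      In : Pred (Fin n) 0ℓ
      In w = w ≡ u ⊎ w ≡ v ⊎ (Adj G w u × Adj G w v)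
      in? : Decidable In
      in? w = (w Fin.≟ u) ⊎-dec (w Fin.≟ v) ⊎-dec (adj? w u ×-dec adj? w v)
      K : Subset n
      K = comprehension in?
      u∈K : u ∈ K
      u∈K = ∈-comprehension⁺ in? (inj₁ refl)
      v∈K : v ∈ K
      v∈K = ∈-comprehension⁺ in? (inj₂ (inj₁ refl))
      adjacent : ∀ {x y} → In x → In y → x ≢ y → Adj G x y
      adjacent (inj₁ refl) (inj₁ refl) x≢y = contradiction refl x≢y
      adjacent (inj₁ refl) (inj₂ (inj₁ refl)) _ = uv
      adjacent (inj₁ refl) (inj₂ (inj₂ (yu , _))) _ = adj-sym yu
      adjacent (inj₂ (inj₁ refl)) (inj₁ refl) _ = adj-sym uv
      adjacent (inj₂ (inj₁ refl)) (inj₂ (inj₁ refl)) x≢y = contradiction refl x≢y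
      adjacent (inj₂ (inj₁ refl)) (inj₂ (inj₂ (_ , yv))) _ = adj-sym yv
      adjacent (inj₂ (inj₂ (xu , _))) (inj₁ refl) _ = xu
      adjacent (inj₂ (inj₂ (_ , xv))) (inj₂ (inj₁ refl)) _ = xv
      adjacent (inj₂ (inj₂ (xu , xv))) (inj₂ (inj₂ (yu , yv))) x≢y =
        common-neighbours-adjacent uv x≢y xu xv yu yv
      clique : IsClique G K
      clique x y x∈K y∈K = adjacent (∈-comprehension⁻ in? x∈K) (∈-comprehension⁻ in? y∈K)
      max : ∀ w → w ∉ K → ¬ (∀ x → x ∈ K → Adj G w x)
      max w w∉K all = w∉K (∈-comprehension⁺ in? (inj₂ (inj₂ (all u u∈K , all v v∈K))))

  -- The graph that keeps the rim and at most two inscribed cliques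

  no-odd-hole-after-deletion : HOHFree G → ∀ D → (∀ K → D K ≡ true → Inscribed G K) →
    (∃ λ K → Inscribed G K × D K ≡ false) → ¬ HasOddHole (SubAdj G D)
  no-odd-hole-after-deletion (no-hole , no-sub-hole) D sound kept (k , odd , v , hole)
    with anySubset? (λ K → D K Bool.≟ true)
  ... | yes deleted = no-sub-hole D (sound , deleted , kept) (k , odd , v , hole)
  -- An empty selection is not a deletion, but it leaves `G` unchanged, and `G` has no odd hole
  -- either.
  ... | no none = no-hole (k , odd , v , IsHole-cong {R = SubAdj G D} {R′ = Adj G}
                    proj₁ (λ uv → uv , λ (K , DK , _) → none (K , DK)) {v = v} hole)

  -- Taking `A` and `B` equal keeps a single clique, the case used for the gaps of one clique.
  deleteOthers : Subset n → Subset n → Subset n → Bool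
  deleteOthers A B K = does (inscribed? K ×-dec ¬? (K ≟ˢ A) ×-dec ¬? (K ≟ˢ B))

  Keep : Subset n → Subset n → Rel n
  Keep A B = SubAdj G (deleteOthers A B)

  InA∪InB : Subset n → Subset n → Rel n
  InA∪InB A B u v = (u ∈ A × v ∈ A) ⊎ (u ∈ B × v ∈ B)

  module _ {A B : Subset n} where

    deleteOthers⁻ : ∀ {K} → deleteOthers A B K ≡ true → Inscribed G K × K ≢ A × K ≢ B
    deleteOthers⁻ {K} = does-true (inscribed? K ×-dec ¬? (K ≟ˢ A) ×-dec ¬? (K ≟ˢ B))

    deleteOthers⁺ : ∀ {K} → Inscribed G K → K ≢ A → K ≢ B → deleteOthers A B K ≡ true
    deleteOthers⁺ {K} i K≢A K≢B = dec-true (inscribed? K ×-dec ¬? (K ≟ˢ A) ×-dec ¬? (K ≟ˢ B)) (i , K≢A , K≢B)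

    keep-no-odd-hole : HOHFree G → Inscribed G A → ¬ HasOddHole (Keep A B)
    keep-no-odd-hole hoh A-ins = no-odd-hole-after-deletion hoh (deleteOthers A B)
      (λ K → proj₁ ∘ deleteOthers⁻)
      (A , A-ins , dec-false (inscribed? A ×-dec ¬? (A ≟ˢ A) ×-dec ¬? (A ≟ˢ B)) (λ (_ , A≢A , _) → A≢A refl))

    keep-sym : ∀ {u v} → Keep A B u v → Keep A B v u
    keep-sym (uv , kept) = adj-sym uv , λ (K , DK , v∈K , u∈K) → kept (K , DK , u∈K , v∈K)

module MultisunFacts {n} {G : Graph n} {σ : Fin n → Fin n} (ms : IsMultisun G σ) where

  open GraphFacts G
  open IsMultisun ms

  rim-adj : ∀ {u v} → u ≢ v → RimAdj σ u v → Adj G u v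
  rim-adj {u} {v} u≢v uv = proj₁ (rimEdgesMax u v uv) u v (p⊆p∪q _ (x∈⁅x⁆ u)) (q⊆p∪q _ _ (x∈⁅x⁆ v)) u≢v

  -- A rim edge is a maximal clique, which `w` would extend.
  no-rim-triangle : ∀ {u v w} → RimAdj σ u v → Adj G w u → Adj G w v → ⊥
  no-rim-triangle {u} {v} {w} uv wu wv = proj₂ (rimEdgesMax u v uv) w w∉ adjacent
    where
    either : ∀ {x} → x ∈ ⁅ u ⁆ ∪ ⁅ v ⁆ → x ≡ u ⊎ x ≡ v
    either x∈ with x∈p∪q⁻ ⁅ u ⁆ ⁅ v ⁆ x∈
    ... | inj₁ x∈u = inj₁ (x∈⁅y⁆⇒x≡y u x∈u)
    ... | inj₂ x∈v = inj₂ (x∈⁅y⁆⇒x≡y v x∈v)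
    w∉ : w ∉ ⁅ u ⁆ ∪ ⁅ v ⁆
    w∉ w∈ with either w∈
    ... | inj₁ w≡u = adj⇒≢ wu w≡u
    ... | inj₂ w≡v = adj⇒≢ wv w≡v
    adjacent : ∀ x → x ∈ ⁅ u ⁆ ∪ ⁅ v ⁆ → Adj G w x
    adjacent x x∈ with either x∈
    ... | inj₁ refl = wu
    ... | inj₂ refl = wv

  module _ {A B : Subset n} where

    keep-rim : ∀ {u v} → u ≢ v → RimAdj σ u v → Keep A B u v
    keep-rim u≢v uv = rim-adj u≢v uv , λ (K , DK , u∈K , v∈K) →
      let ((max , ≢2) , _) = deleteOthers⁻ DK in otherNonCons K max ≢2 _ _ u∈K v∈K uv

    -- A deleted clique through both vertices would share an edge with `A` and so coincide with it.
    keep-left : ∀ {u v} → Inscribed G A → u ∈ A → v ∈ A → u ≢ v → Keep A B u v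
    keep-left ((clique , max) , _) u∈A v∈A u≢v = clique _ _ u∈A v∈A u≢v , λ (K , DK , u∈K , v∈K) →
      let ((K-max , _) , K≢A , _) = deleteOthers⁻ DK in
      K≢A (maxClique-unique diamondFree K-max (clique , max) u≢v u∈K v∈K u∈A v∈A)

    keep-right : ∀ {u v} → Inscribed G B → u ∈ B → v ∈ B → u ≢ v → Keep A B u v
    keep-right ((clique , max) , _) u∈B v∈B u≢v = clique _ _ u∈B v∈B u≢v , λ (K , DK , u∈K , v∈K) →
      let ((K-max , _) , _ , K≢B) = deleteOthers⁻ DK in
      K≢B (maxClique-unique diamondFree K-max (clique , max) u≢v u∈K v∈K u∈B v∈B)

    -- The edge extends to a maximal clique. If that has size 2 the edge is on the rim; otherwise
    -- the clique is inscribed, and having survived deletion it is `A` or `B`.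
    keep-inv : ∀ {u v} → Keep A B u v → RimAdj σ u v ⊎ InA∪InB A B u v
    keep-inv {u} {v} (uv , kept) with K , max , u∈K , v∈K ← edge-maxClique diamondFree uv
      with ∣ K ∣ ≟ 2 | K ≟ˢ A | K ≟ˢ B
    ... | yes ≡2 | _        | _        = inj₁ (max2⇒rim K max ≡2 u v u∈K v∈K (adj⇒≢ uv))
    ... | no _   | yes refl | _        = inj₂ (inj₁ (u∈K , v∈K))
    ... | no _   | no _     | yes refl = inj₂ (inj₂ (u∈K , v∈K))
    ... | no ≢2  | no K≢A   | no K≢B   =
      contradiction (K , deleteOthers⁺ (max , ≢2) K≢A K≢B , u∈K , v∈K) kept

-- Parity on a circle with two colours

None : Pred ℕ 0ℓ → ℕ → ℕ → Set
None P s e = ∀ {y} → s < y → y < e → ¬ P y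

none-⊆ : ∀ {P : Pred ℕ 0ℓ} {s e s′ e′} → s ≤ s′ → e′ ≤ e → None P s e → None P s′ e′
none-⊆ s≤s′ e′≤e none s′<y y<e′ = none (≤-<-trans s≤s′ s′<y) (<-≤-trans y<e′ e′≤e)

bit : Bool → Parity
bit false = 0ℙ
bit true  = 1ℙ

module Marked {P : Pred ℕ 0ℓ} (P? : Decidable P) where

  next-after : ∀ {s e} → s < e → P e → ∃ λ x → s < x × x ≤ e × P x × None P s x
  next-after {s} {e} s<e Pe = go e s<e (m≤n+m e s)
    where
    go : ∀ d {s} → s < e → e ≤ s + d → ∃ λ x → s < x × x ≤ e × P x × None P s x
    go zero    {s} s<e e≤s+d = contradiction (≤-trans e≤s+d (≤-reflexive (+-identityʳ s))) (<⇒≱ s<e)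
    go (suc d) {s} s<e e≤s+d with P? (suc s)
    ... | yes Ps⁺ = suc s , n<1+n s , s<e , Ps⁺ , λ s<y y<s⁺ → contradiction s<y (≤⇒≯ (s≤s⁻¹ y<s⁺))
    ... | no ¬Ps⁺ with x , s⁺<x , x≤e , Px , none ← go d
                         (≤∧≢⇒< s<e λ { refl → ¬Ps⁺ Pe }) (≤-trans e≤s+d (≤-reflexive (+-suc s d)))
      = x , <-trans (n<1+n s) s⁺<x , x≤e , Px , λ s<y y<x Py → case-y s<y y<x Py none
      where
      case-y : ∀ {x y} → s < y → y < x → P y → None P (suc s) x → ⊥
      case-y s<y y<x Py none with m≤n⇒m<n∨m≡n s<y
      ... | inj₁ s⁺<y = none s⁺<y y<x Py
      ... | inj₂ refl = ¬Ps⁺ Py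

  last-before : ∀ {s e} → s < e → P s → ∃ λ x → s ≤ x × x < e × P x × None P x e
  last-before {s} {suc e} s<e⁺ Ps with P? e
  ... | yes Pe = e , s≤s⁻¹ s<e⁺ , n<1+n e , Pe , λ e<y y<e⁺ → contradiction e<y (≤⇒≯ (s≤s⁻¹ y<e⁺))
  ... | no ¬Pe with x , s≤x , x<e , Px , none ← last-before
                      (≤∧≢⇒< (s≤s⁻¹ s<e⁺) λ { refl → ¬Pe Ps }) Ps
    = x , s≤x , <-trans x<e (n<1+n e) , Px , none⁺
    where
    none⁺ : None P x (suc e)
    none⁺ x<y y<e⁺ Py with m≤n⇒m<n∨m≡n (s≤s⁻¹ y<e⁺)
    ... | inj₁ y<e  = none x<y y<e Py
    ... | inj₂ refl = ¬Pe Py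

  -- Stepping back from `e` to the preceding mark crosses one gap at a time until `s` is reached.
  constant-on-marks : ∀ {A : Set} (g : ℕ → A) →
    (∀ {s e} → s < e → P s → P e → None P s e → g s ≡ g e) →
    ∀ {s e} → s ≤ e → P s → P e → g s ≡ g e
  constant-on-marks g gap {s} s≤e Ps = go (<-wellFounded _) s≤e
    where
    go : ∀ {e} → Acc _<_ e → s ≤ e → P e → g s ≡ g e
    go (acc rec) s≤e Pe with m≤n⇒m<n∨m≡n s≤e
    ... | inj₂ refl = refl
    ... | inj₁ s<e with x , s≤x , x<e , Px , none ← last-before s<e Ps =
      trans (go (rec x<e) s≤x Px) (gap x<e Px Pe none)

  -- Parity of the number of marks among the positions before `t`.
  κ : ℕ → Parity
  κ zero    = 0ℙ
  κ (suc t) = κ t ℙ.+ bit (does (P? t))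

  κ-none : ∀ {s e} → s ≤ e → (∀ {y} → s ≤ y → y < e → ¬ P y) → κ e ≡ κ s
  κ-none {e = zero}  z≤n _ = refl
  κ-none {s} {suc e} s≤e⁺ none with m≤n⇒m<n∨m≡n s≤e⁺
  ... | inj₂ refl = refl
  ... | inj₁ s<e⁺ with P? e
  ...   | yes Pe = contradiction Pe (none (s≤s⁻¹ s<e⁺) (n<1+n e))
  ...   | no _   = trans (ℙ.+-identityʳ (κ e))
    (κ-none (s≤s⁻¹ s<e⁺) λ s≤y y<e → none s≤y (<-trans y<e (n<1+n e)))

  κ-gap : ∀ {s e} → P s → s < e → None P s e → κ e ≡ κ s ⁻¹
  κ-gap {s} Ps s<e none = trans (κ-none s<e none) κ-step
    where
    κ-step : κ (suc s) ≡ κ s ⁻¹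
    κ-step with P? s
    ... | yes _  = ℙ.+-comm (κ s) 1ℙ
    ... | no ¬Ps = contradiction Ps ¬Ps

  module Periodic {n} (P⁺ : ∀ {t} → P t → P (t + n)) (P⁻ : ∀ {t} → P (t + n) → P t) where

    bit-periodic : ∀ t → bit (does (P? (t + n))) ≡ bit (does (P? t))
    bit-periodic t with P? (t + n) | P? t
    ... | yes _  | yes _  = refl
    ... | no _   | no _   = refl
    ... | yes p  | no ¬p  = contradiction (P⁻ p) ¬p
    ... | no ¬p  | yes p  = contradiction (P⁺ p) ¬p

    κ-period : ∀ t → κ (t + n) ≡ κ t ℙ.+ κ n
    κ-period zero    = refl
    κ-period (suc t) = begin
      κ (t + n) ℙ.+ bit (does (P? (t + n)))      ≡⟨ cong₂ ℙ._+_ (κ-period t) (bit-periodic t) ⟩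
      κ t ℙ.+ κ n ℙ.+ bit (does (P? t))          ≡⟨ ℙ.+-assoc (κ t) (κ n) _ ⟩
      κ t ℙ.+ (κ n ℙ.+ bit (does (P? t)))        ≡⟨ cong (κ t ℙ.+_) (ℙ.+-comm (κ n) _) ⟩
      κ t ℙ.+ (bit (does (P? t)) ℙ.+ κ n)        ≡⟨ ℙ.+-assoc (κ t) _ (κ n) ⟨
      κ t ℙ.+ bit (does (P? t)) ℙ.+ κ n          ∎
      where open ≡-Reasoning

OddGaps : Pred ℕ 0ℓ → Set
OddGaps P = ∀ {s e} → s < e → P s → P e → None P s e → parity e ≡ parity s ⁻¹

parity-+n : ∀ {n} → parity n ≡ 1ℙ → ∀ t → parity (t + n) ≡ parity t ⁻¹
parity-+n {n} n-odd t = begin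
  parity (t + n)          ≡⟨ ℙ.+-homo-+ t n ⟩
  parity t ℙ.+ parity n   ≡⟨ cong (parity t ℙ.+_) n-odd ⟩
  parity t ℙ.+ 1ℙ         ≡⟨ ℙ.+-comm (parity t) 1ℙ ⟩
  parity t ⁻¹             ∎
  where open ≡-Reasoning

⁻¹-+-⁻¹ : ∀ p q → p ⁻¹ ℙ.+ q ⁻¹ ≡ p ℙ.+ q
⁻¹-+-⁻¹ 0ℙ q = ℙ.⁻¹-involutive q
⁻¹-+-⁻¹ 1ℙ q = refl

module OddMarked {P : Pred ℕ 0ℓ} (P? : Decidable P) {n} (n-odd : parity n ≡ 1ℙ)
  (P⁺ : ∀ {t} → P t → P (t + n)) (P⁻ : ∀ {t} → P (t + n) → P t) (gap : OddGaps P) where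

  open Marked P?
  open Periodic P⁺ P⁻

  -- Across a gap both summands flip: the first because the gap is odd, the second because one mark
  -- is passed.
  parity+κ : ∀ {s e} → s ≤ e → P s → P e → parity s ℙ.+ κ s ≡ parity e ℙ.+ κ e
  parity+κ = constant-on-marks (λ t → parity t ℙ.+ κ t) λ {s} s<e Ps Pe none →
    sym (trans (cong₂ ℙ._+_ (gap s<e Ps Pe none) (κ-gap Ps s<e none)) (⁻¹-+-⁻¹ (parity s) (κ s)))

  -- Between `s` and `s + n` the parity of the position flips, so the count over a full turn must
  -- flip as well.
  κ-odd : ∀ {s} → P s → κ n ≡ 1ℙ
  κ-odd {s} Ps = solve (parity s) (κ s) (κ n) (trans (parity+κ (m≤m+n s n) Ps (P⁺ Ps))
    (cong₂ ℙ._+_ (parity-+n n-odd s) (κ-period s)))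
    where
    solve : ∀ p q r → p ℙ.+ q ≡ p ⁻¹ ℙ.+ (q ℙ.+ r) → r ≡ 1ℙ
    solve p  q  1ℙ _ = refl
    solve 0ℙ 0ℙ 0ℙ ()
    solve 0ℙ 1ℙ 0ℙ ()
    solve 1ℙ 0ℙ 0ℙ ()
    solve 1ℙ 1ℙ 0ℙ ()

-- Only the open interval is required to be clear; that no end carries both colours comes from
-- disjointness.
record Arc (P Q : Pred ℕ 0ℓ) (s e : ℕ) : Set where
  field
    s<e   : s < e
    start : P s
    end   : Q e
    noneˢ : None P s e
    noneᵉ : None Q s e

-- The hypotheses say that two arcs without a common end have lengths of the same parity.
module TwoColours {n} (n-odd : parity n ≡ 1ℙ)
  {P Q : Pred ℕ 0ℓ} (P? : Decidable P) (Q? : Decidable Q)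
  (P⁺ : ∀ {t} → P t → P (t + n))
  (Q⁺ : ∀ {t} → Q t → Q (t + n)) (Q⁻ : ∀ {t} → Q (t + n) → Q t)
  (gapP : OddGaps P) (gapQ : OddGaps Q)
  (disjoint : ∀ {t} → P t → Q t → ⊥)
  (someQ : ∀ s → ∃ λ x → s ≤ x × Q x)
  (otherP : ∀ {s} → P s → ∃ λ x → s < x × x < s + n × P x)
  (otherQ : ∀ {s} → Q s → ∃ λ x → s < x × x < s + n × Q x)
  (opposite : ∀ {s e s′ e′} → Arc P Q s e → Arc Q P s′ e′ → e < s′ → e′ < s + n →
    parity s ℙ.+ parity e ≡ parity s′ ℙ.+ parity e′)
  (sameP : ∀ {s e s′ e′} → Arc P Q s e → Arc P Q s′ e′ → e < s′ → e′ < s + n →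
    parity s ℙ.+ parity e ≡ parity s′ ℙ.+ parity e′)
  (sameQ : ∀ {s e s′ e′} → Arc Q P s e → Arc Q P s′ e′ → e < s′ → e′ < s + n →
    parity s ℙ.+ parity e ≡ parity s′ ℙ.+ parity e′)
  where

  private
    module P = Marked P?
    module Q = Marked Q?
    module Q-odd = OddMarked Q? n-odd Q⁺ Q⁻ gapQ

  module OddGap {s e} (s<e : s < e) (Ps : P s) (Pe : P e) (none : None P s e)
    (odd : Q.κ e ≢ Q.κ s) where

    -- `P` has another mark within the turn after `s`, and `e` is the first one.
    e<s+n : e < s + n
    e<s+n with x , s<x , x<s+n , Px ← otherP Ps = ≤-<-trans (≮⇒≥ λ x<e → none s<x x<e Px) x<s+n

    -- The two outer arcs have lengths of equal parity while the gap is odd, so `b₁` and `b₂` differ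
    -- in parity; an odd number of `Q`-marks from `b₁` to `b₂` makes them agree.
    several : ∀ {b₁ b₂} → s < b₁ → b₁ < b₂ → b₂ < e → Q b₁ → Q b₂ →
      None Q s b₁ → None Q b₂ e → ⊥
    several {b₁} {b₂} s<b₁ b₁<b₂ b₂<e Qb₁ Qb₂ none₁ none₂ = solve (parity s) (parity b₁) (parity b₂) (Q.κ b₂)
      (trans (opposite
        (record { s<e = s<b₁ ; start = Ps ; end = Qb₁ ; noneᵉ = none₁
                ; noneˢ = none-⊆ ≤-refl (<⇒≤ (<-trans b₁<b₂ b₂<e)) none })
        (record { s<e = b₂<e ; start = Qb₂ ; end = Pe ; noneˢ = none₂
                ; noneᵉ = none-⊆ (<⇒≤ (<-trans s<b₁ b₁<b₂)) ≤-refl none })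
        b₁<b₂ e<s+n) (cong (parity b₂ ℙ.+_) (gapP s<e Ps Pe none)))
      (trans (cong (parity b₁ ℙ.+_) (sym (Q.κ-none (<⇒≤ s<b₁) none-Q))) (Q-odd.parity+κ (<⇒≤ b₁<b₂) Qb₁ Qb₂))
      (λ eq → odd (trans (Q.κ-gap Qb₂ b₂<e none₂) eq))
      where
      none-Q : ∀ {y} → s ≤ y → y < b₁ → ¬ Q y
      none-Q s≤y y<b₁ Qy with m≤n⇒m<n∨m≡n s≤y
      ... | inj₁ s<y  = none₁ s<y y<b₁ Qy
      ... | inj₂ refl = disjoint Ps Qy
      -- Here `x`, `y`, `z` are the parities of `s`, `b₁`, `b₂`, while `m` and `k` are the counts at
      -- `b₂` and `s`.
      solve : ∀ x y z m {k} → x ℙ.+ y ≡ z ℙ.+ x ⁻¹ → y ℙ.+ k ≡ z ℙ.+ m → m ⁻¹ ≢ k → ⊥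
      solve 0ℙ 0ℙ 1ℙ m eq₁ eq₂ m⁻¹≢k = m⁻¹≢k (sym eq₂)
      solve 0ℙ 1ℙ 0ℙ m {k} eq₁ eq₂ m⁻¹≢k = m⁻¹≢k (trans (cong _⁻¹ (sym eq₂)) (ℙ.⁻¹-involutive k))
      solve 1ℙ 0ℙ 1ℙ m eq₁ eq₂ m⁻¹≢k = m⁻¹≢k (sym eq₂)
      solve 1ℙ 1ℙ 0ℙ m {k} eq₁ eq₂ m⁻¹≢k = m⁻¹≢k (trans (cong _⁻¹ (sym eq₂)) (ℙ.⁻¹-involutive k))

    -- One turn earlier, `x` falls on `s`, which carries the other colour, or strictly between `s`
    -- and `b`.
    beyond : ∀ {b x} → None Q s b → s + n ≤ x → x < b + n → ¬ Q x
    beyond {b} none₁ s+n≤x x<b+n Qx with d , refl ← m≤n⇒∃[o]m+o≡n s+n≤x =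
      case (m≤n⇒m<n∨m≡n (m≤m+n s d)) (+-cancelʳ-< n (s + d) b (subst (_< b + n) shift x<b+n))
           (Q⁻ (subst Q shift Qx))
      where
      shift : s + n + d ≡ s + d + n
      shift = trans (+-assoc s n d) (trans (cong (s +_) (+-comm n d)) (sym (+-assoc s d n)))
      case : ∀ {y} → s < y ⊎ s ≡ y → y < b → Q y → ⊥
      case (inj₁ s<y) y<b Qy = none₁ s<y y<b Qy
      case (inj₂ refl) _ Qs = disjoint Ps Qs

    -- The order is `s` < `b` < `e` ≤ `q₁` < `b′` < `b″` < `q₂` ≤ `s + n`. Parity of length passes
    -- from the arc `s`, `b` to `q₁`, `b′`, then to `b″`, `q₂`, then to `b`, `e`, which would make
    -- the gap even.
    single : ∀ {b} → s < b → b < e → Q b → None Q s b → None Q b e → ⊥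
    single {b} s<b b<e Qb none₁ none₂
      with x , b<x , x<b+n , Qx ← otherQ Qb
      with b′ , b<b′ , b′≤x , Qb′ , none-bb′ ← Q.next-after b<x Qx
      with b″ , b′≤b″ , b″<b+n , Qb″ , none-b″b ← Q.last-before (≤-<-trans b′≤x x<b+n) Qb′
      with q₁ , e≤q₁ , q₁<b′ , Pq₁ , none-q₁ ← P.last-before {e} {b′}
             (≤∧≢⇒< (≮⇒≥ λ b′<e → none₂ b<b′ b′<e Qb′) λ { refl → disjoint Pe Qb′ }) Pe
      with q₂ , b″<q₂ , q₂≤s+n , Pq₂ , none-q₂ ← P.next-after {b″} {s + n}
             (≰⇒> λ s+n≤b″ → beyond none₁ s+n≤b″ b″<b+n Qb″) (P⁺ Ps)
      = ps≢pe (+-cancel (trans P₁~Q₁ (trans Q₁~Q₂ (sym P₂~Q₂))))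
      where
      parity-b′ : parity b′ ≡ parity b ⁻¹
      parity-b′ = gapQ b<b′ Qb Qb′ none-bb′
      parity-b″ : parity b″ ≡ parity b
      parity-b″ = ℙ.⁻¹-injective (trans (sym (gapQ b″<b+n Qb″ (Q⁺ Qb) none-b″b)) (parity-+n n-odd b))
      b′<b″ : b′ < b″
      -- `b′` is an odd distance after `b`; `b″` is an odd distance before `b + n`, hence an even
      -- one after `b`.
      b′<b″ = ≤∧≢⇒< b′≤b″ λ { refl → ℙ.p≢p⁻¹ (parity b) (trans (sym parity-b″) parity-b′) }
      b″<s+n : b″ < s + n
      b″<s+n = <-≤-trans b″<q₂ q₂≤s+n
      arc₁ : Arc P Q s b
      arc₁ = record { s<e = s<b ; start = Ps ; end = Qb ; noneˢ = none-⊆ ≤-refl (<⇒≤ b<e) none ; noneᵉ = none₁ }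
      arc₂ : Arc Q P b e
      arc₂ = record { s<e = b<e ; start = Qb ; end = Pe ; noneˢ = none₂ ; noneᵉ = none-⊆ (<⇒≤ s<b) ≤-refl none }
      arc₃ : Arc P Q q₁ b′
      arc₃ = record { s<e = q₁<b′ ; start = Pq₁ ; end = Qb′ ; noneˢ = none-q₁
                    ; noneᵉ = none-⊆ (<⇒≤ (<-≤-trans b<e e≤q₁)) ≤-refl none-bb′ }
      arc₄ : Arc Q P b″ q₂
      arc₄ = record { s<e = b″<q₂ ; start = Qb″ ; end = Pq₂ ; noneᵉ = none-q₂
                    ; noneˢ = none-⊆ ≤-refl (≤-trans q₂≤s+n (+-monoˡ-≤ n (<⇒≤ s<b))) none-b″b }
      P₁~Q₁ : parity s ℙ.+ parity b ≡ parity q₁ ℙ.+ parity b′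
      P₁~Q₁ = sameP arc₁ arc₃ (<-≤-trans b<e e≤q₁) (<-trans b′<b″ b″<s+n)
      P₂~Q₂ : parity b ℙ.+ parity e ≡ parity b″ ℙ.+ parity q₂
      P₂~Q₂ = sameQ arc₂ arc₄ (≤-<-trans (≤-trans e≤q₁ (<⇒≤ q₁<b′)) b′<b″) (≤-<-trans q₂≤s+n (+-monoˡ-< n s<b))
      Q₁~Q₂ : parity q₁ ℙ.+ parity b′ ≡ parity b″ ℙ.+ parity q₂
      Q₁~Q₂ = opposite arc₃ arc₄ b′<b″ (≤-<-trans q₂≤s+n (+-monoˡ-< n (<-≤-trans s<e e≤q₁)))
      ps≢pe : parity s ≢ parity e
      ps≢pe eq = ℙ.p≢p⁻¹ (parity s) (trans eq (gapP s<e Ps Pe none))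
      +-cancel : parity s ℙ.+ parity b ≡ parity b ℙ.+ parity e → parity s ≡ parity e
      +-cancel eq = ℙ.+-cancelˡ-≡ (parity b) _ _ (trans (ℙ.+-comm (parity b) (parity s)) eq)

    impossible : ⊥
    impossible with x , s≤x , Qx ← someQ s
      with b₁ , s<b₁ , _ , Qb₁ , none₁ ← Q.next-after (≤∧≢⇒< s≤x λ { refl → disjoint Ps Qx }) Qx
      with b₁ <? e
    -- A gap without `Q`-marks leaves the count unchanged.
    ... | no b₁≮e = odd (Q.κ-none (<⇒≤ s<e) none-Q)
      where
      none-Q : ∀ {y} → s ≤ y → y < e → ¬ Q y
      none-Q s≤y y<e Qy with m≤n⇒m<n∨m≡n s≤y
      ... | inj₁ s<y  = none₁ s<y (<-≤-trans y<e (≮⇒≥ b₁≮e)) Qy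
      ... | inj₂ refl = disjoint Ps Qy
    ... | yes b₁<e with b₂ , b₁≤b₂ , b₂<e , Qb₂ , none₂ ← Q.last-before b₁<e Qb₁
      with m≤n⇒m<n∨m≡n b₁≤b₂
    ...   | inj₁ b₁<b₂ = several s<b₁ b₁<b₂ b₂<e Qb₁ Qb₂ none₁ none₂
    ...   | inj₂ refl  = single s<b₁ b₁<e Qb₁ none₁ none₂

  κ-constant : ∀ {s e} → s < e → P s → P e → None P s e → Q.κ s ≡ Q.κ e
  κ-constant {s} {e} s<e Ps Pe none with Q.κ e ℙ.≟ Q.κ s
  ... | yes eq = sym eq
  ... | no odd = ⊥-elim (OddGap.impossible s<e Ps Pe none odd)

  -- The count of `Q`-marks has constant parity on `P`, yet a full turn flips it because `Q` has an
  -- odd number of marks per turn.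
  unmarked : ∀ {s} → ¬ P s
  unmarked {s} Ps = ℙ.p≢p⁻¹ (Q.κ s)
    (trans (P.constant-on-marks Q.κ κ-constant (m≤m+n s n) Ps (P⁺ Ps))
    (trans (Q.Periodic.κ-period Q⁺ Q⁻ s)
    (trans (cong (Q.κ s ℙ.+_) (Q-odd.κ-odd (proj₂ (proj₂ (someQ 0))))) (ℙ.+-comm (Q.κ s) 1ℙ))))

-- The N-conditions

-- `κ` grows at the last position, whereas `sum` splits off the first one.
κ-suc : ∀ {P : Pred ℕ 0ℓ} (P? : Decidable P) m →
  Marked.κ P? (suc m) ≡ bit (does (P? 0)) ℙ.+ Marked.κ (P? ∘ suc) m
κ-suc P? zero    = sym (ℙ.+-identityʳ _)
κ-suc P? (suc m) = trans (cong (ℙ._+ _) (κ-suc P? m)) (ℙ.+-assoc (bit (does (P? 0))) _ _)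

κ≡sum : ∀ {P : Pred ℕ 0ℓ} (P? : Decidable P) m → Marked.κ P? m ≡ sum {m} (λ i → bit (does (P? (toℕ i))))
κ≡sum P? zero    = refl
κ≡sum P? (suc m) = trans (κ-suc P? m) (cong (bit (does (P? 0)) ℙ.+_) (κ≡sum (P? ∘ suc) m))

size≡sum : ∀ {m} (A : Subset m) → parity ∣ A ∣ ≡ sum (λ i → bit (does (i ∈? A)))
size≡sum []            = refl
size≡sum (outside ∷ A) = size≡sum A
size≡sum (inside ∷ A)  = trans (sym (ℙ.⁻¹-involutive _))
  (cong _⁻¹ (trans (ℙ.suc-homo-⁻¹ ∣ A ∣) (size≡sum A)))

module HOHFreeMultisun {k : ℕ} {G : Graph (suc k)} {σ : Fin (suc k) → Fin (suc k)}
  (ms : IsMultisun G σ) (hoh : HOHFree G) where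

  open IsMultisun ms
  open GraphFacts G
  open MultisunFacts ms
  open Rim σ σ-injective

  private
    n : ℕ
    n = suc k

  n-odd : parity n ≡ 1ℙ
  n-odd = odd⇒parity n oddOrder

  V-suc-≢ : ∀ p → V p ≢ V (suc p)
  V-suc-≢ p = V-distinct (n<1+n p) (subst (_< p + n) (+-comm p 1) (+-monoʳ-< p (≤-trans (s≤s (s≤s z≤n)) atLeast3)))

  module Holes {A B : Subset n} (A-ins : Inscribed G A) = RimHoles (Keep A B) (InA∪InB A B)
    (keep-sym {A} {B})
    (λ p → keep-rim {A} {B} (V-suc-≢ p) (rim-suc p))
    (keep-inv {A} {B}) (keep-no-odd-hole {A} {B} hoh A-ins)

  Mark : Subset n → Pred ℕ 0ℓ
  Mark A t = V t ∈ A

  mark? : ∀ A → Decidable (Mark A)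
  mark? A t = V t ∈? A

  mark⁺ : ∀ {A t} → Mark A t → Mark A (t + n)
  mark⁺ {A} {t} = subst (_∈ A) (sym (V-periodic t))

  mark⁻ : ∀ {A t} → Mark A (t + n) → Mark A t
  mark⁻ {A} {t} = subst (_∈ A) (V-periodic t)

  rim-adj-suc : ∀ p → Adj G (V p) (V (suc p))
  rim-adj-suc p = rim-adj (V-suc-≢ p) (rim-suc p)

  someMark : ∀ {A} → Inscribed G A → ∀ s → ∃ λ x → s ≤ x × Mark A x
  someMark (max , _) s with u , u∈A ← maxClique-nonempty Fin.zero max
    with x , s≤x , _ , refl ← V-onto s u = x , s≤x , u∈A

  -- The rim successor of `V s` is a neighbour outside `A`, so `V s` alone is not a maximal clique.
  otherMark : ∀ {A s} → Inscribed G A → Mark A s → ∃ λ x → s < x × x < s + n × Mark A x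
  otherMark {A} {s} (max , ≢2) Vs∈A
    with u , u∈A , u≢Vs ← maxClique-other max Vs∈A (adj-sym (rim-adj-suc s))
           (λ Vs⁺∈A → otherNonCons A max ≢2 _ _ Vs∈A Vs⁺∈A (rim-suc s))
    with x , s≤x , x<s+n , refl ← V-onto s u =
    x , ≤∧≢⇒< s≤x (λ { refl → u≢Vs refl }) , x<s+n , u∈A

  -- Gaps and size of one inscribed clique

  module _ {A : Subset n} (A-ins : Inscribed G A) where

    private
      A-clique : IsClique G A
      A-clique = proj₁ (proj₁ A-ins)

    -- `ℓ` counts the interior vertices. None would make two vertices of `A` consecutive, and one
    -- would give a triangle on a rim edge. Otherwise the first vertex and the remaining interval,
    -- joined by a rim edge and an edge of `A`, form a hole of `ℓ` + 2 vertices.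
    gap-even : ∀ {s} ℓ → suc s + ℓ < s + n → Mark A s → Mark A (suc s + ℓ) →
      None (Mark A) s (suc s + ℓ) → parity ℓ ≡ 0ℙ × 2 ≤ ℓ
    gap-even {s} zero e<s+n Vs∈A Ve∈A none =
      contradiction (rim-suc s) (otherNonCons A (proj₁ A-ins) (proj₂ A-ins) _ _ Vs∈A
        (subst (Mark A) (+-identityʳ (suc s)) Ve∈A))
    gap-even {s} (suc zero) e<s+n Vs∈A Ve∈A none = contradiction
      (A-clique _ _ Ve∈A Vs∈A (V-distinct (s≤s (m≤m+n s 1)) e<s+n ∘ sym)) λ ws →
      no-rim-triangle (rim-suc s) ws (subst (λ x → Adj G (V x) (V (suc s))) (sym (+-comm (suc s) 1))
        (adj-sym (rim-adj-suc (suc s))))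
    gap-even {s} ℓ@(suc (suc _)) e<s+n Vs∈A Ve∈A none = even , s≤s (s≤s z≤n)
      where
      open Holes {A} {A} A-ins
      open TwoIntervals {s} {0} {suc s} {ℓ} (s≤s (≤-reflexive (+-identityʳ s))) e<s+n
      only-last : ∀ {y} → y ≤ ℓ → Mark A (suc s + y) → y ≡ ℓ
      only-last {y} y≤ℓ Vy∈A with m≤n⇒m<n∨m≡n y≤ℓ
      ... | inj₁ y<ℓ = contradiction Vy∈A (none (s≤s (m≤m+n s y)) (+-monoʳ-< (suc s) y<ℓ))
      ... | inj₂ y≡ℓ = y≡ℓ
      both : ∀ {u v} → InA∪InB A A u v → u ∈ A × v ∈ A
      both (inj₁ p) = p
      both (inj₂ p) = p
      even : parity ℓ ≡ 0ℙ
      even = even-parallel (s≤s (s≤s (s≤s (s≤s z≤n))))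
        (λ x<y y≤0 → contradiction (<-≤-trans x<y y≤0) λ ())
        (λ x<y y≤ℓ l → <⇒≢ (<-≤-trans x<y y≤ℓ) (only-last (<⇒≤ (<-≤-trans x<y y≤ℓ)) (proj₁ (both l))))
        (λ x≤0 y≤ℓ l → inj₂ (n≤0⇒n≡0 x≤0 , only-last y≤ℓ (proj₂ (both l))))
        (subst₂ (λ x y → Keep A A (V x) (V y)) (sym (+-identityʳ s)) (sym (+-identityʳ (suc s)))
          (keep-rim {A} {A} (adj⇒≢ (rim-adj-suc s)) (rim-suc s)))
        (keep-left {A} {A} A-ins (subst (Mark A) (sym (+-identityʳ s)) Vs∈A) Ve∈A
          (subst (λ x → V x ≢ V (suc s + ℓ)) (sym (+-identityʳ s)) (V-distinct (s≤s (m≤m+n s ℓ)) e<s+n)))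

    odd-gaps : OddGaps (Mark A)
    odd-gaps {s} {e} s<e Vs∈A Ve∈A none with <-cmp e (s + n)
    ... | tri> _ _ s+n<e = contradiction (mark⁺ {A} {s} Vs∈A) (none (m<m+n s z<s) s+n<e)
    ... | tri≈ _ refl _ = parity-+n n-odd s
    ... | tri< e<s+n _ _ with ℓ , refl ← m≤n⇒∃[o]m+o≡n s<e = begin
      parity (suc s + ℓ)              ≡⟨ ℙ.+-homo-+ (suc s) ℓ ⟩
      parity (suc s) ℙ.+ parity ℓ     ≡⟨ cong (parity (suc s) ℙ.+_) (proj₁ (gap-even ℓ e<s+n Vs∈A Ve∈A none)) ⟩
      parity (suc s) ℙ.+ 0ℙ           ≡⟨ ℙ.+-identityʳ _ ⟩
      parity (suc s)                  ≡⟨ ℙ.⁻¹-involutive _ ⟨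
      parity (suc s) ⁻¹ ⁻¹            ≡⟨ cong _⁻¹ (ℙ.suc-homo-⁻¹ s) ⟩
      parity s ⁻¹                     ∎
      where open ≡-Reasoning

    private
      π : Permutation n n
      π = permutation σ (λ u → proj₁ (injective⇒onto σ-injective u))
        (λ u → proj₂ (injective⇒onto σ-injective u))
        (λ i → σ-injective (proj₂ (injective⇒onto σ-injective (σ i))))

    -- One turn lists each vertex once, in the order of `σ`; reindexing by that permutation gives
    -- the size.
    κ≡size : Marked.κ (mark? A) n ≡ parity ∣ A ∣
    κ≡size = begin
      Marked.κ (mark? A) n                        ≡⟨ κ≡sum (mark? A) n ⟩
      sum {n} (λ i → bit (does (V (toℕ i) ∈? A))) ≡⟨ sum-cong-≗ (λ i → cong (λ u → bit (does (u ∈? A))) (V-toℕ i)) ⟩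
      sum {n} (λ i → bit (does (σ i ∈? A)))       ≡⟨ sum-permute (λ i → bit (does (i ∈? A))) π ⟨
      sum {n} (λ i → bit (does (i ∈? A)))         ≡⟨ size≡sum A ⟨
      parity ∣ A ∣                                ∎
      where open ≡-Reasoning

    odd-size : Odd ∣ A ∣
    odd-size with x , _ , Vx∈A ← someMark A-ins 0 = parity⇒odd ∣ A ∣ (trans (sym κ≡size)
      (OddMarked.κ-odd (mark? A) {n} n-odd (λ {t} → mark⁺ {A} {t}) (λ {t} → mark⁻ {A} {t}) odd-gaps {x} Vx∈A))

  n1 : N1 G σ
  n1 A A-ins i (suc (suc ℓ)) (_ , m≤n , ends , none) = parity⇒even (suc (suc ℓ)) (proj₁ gap) , s≤s (s≤s (proj₂ gap))
    where
    s : ℕ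
    s = toℕ i
    at : ∀ {t} → rv σ i t ∈ A → V (s + t) ∈ A
    at = subst (_∈ A) (rv≡V i _)
    both : ∀ {u v} → (u ∈ A × v ∈ A) ⊎ (u ∈ A × v ∈ A) → u ∈ A × v ∈ A
    both (inj₁ p) = p
    both (inj₂ p) = p
    inner : None (Mark A) s (suc s + ℓ)
    inner {y} s<y y<e Vy∈A with d , refl ← m≤n⇒∃[o]m+o≡n s<y =
      none (suc d) (s≤s z≤n) (s≤s (s≤s (+-cancelˡ-< (suc s) d ℓ y<e))) A A-ins
        (subst (_∈ A) (trans (cong V (sym (+-suc s d))) (sym (rv≡V i (suc d)))) Vy∈A)
    gap : parity ℓ ≡ 0ℙ × 2 ≤ ℓ
    gap = gap-even A-ins ℓ (subst (_< s + n) (+-suc s ℓ) (+-monoʳ-< s m≤n))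
      (subst (Mark A) (+-identityʳ s) (at (proj₁ (both ends))))
      (subst (Mark A) (+-suc s ℓ) (at (proj₂ (both ends)))) inner
  n1 A A-ins i (suc zero) (s≤s () , _)

  -- Rim arcs between two inscribed cliques

  record Bridge (A B : Subset n) (s ℓ : ℕ) : Set where
    field
      start  : Mark A s
      end    : Mark B (s + ℓ)
      only-A : ∀ {x} → x ≤ ℓ → Mark A (s + x) → x ≡ 0
      only-B : ∀ {x} → x ≤ ℓ → Mark B (s + x) → x ≡ ℓ

    start′ : Mark A (s + 0)
    start′ = subst (Mark A) (sym (+-identityʳ s)) start

    free : ∀ {x y} → x < y → y ≤ ℓ → ¬ InA∪InB A B (V (s + x)) (V (s + y))
    free x<y y≤ℓ (inj₁ (_ , y∈A)) = n≮0 (subst (_ <_) (only-A y≤ℓ y∈A) x<y)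
    free x<y y≤ℓ (inj₂ (x∈B , _)) = <⇒≢ (<-≤-trans x<y y≤ℓ) (only-B (<⇒≤ (<-≤-trans x<y y≤ℓ)) x∈B)

  flip : ∀ {A B u v} → InA∪InB A B u v → InA∪InB B A u v
  flip (inj₁ p) = inj₂ p
  flip (inj₂ p) = inj₁ p

  module _ {A B : Subset n} (A-ins : Inscribed G A) (B-ins : Inscribed G B) where

    -- An edge of `B` joins the inner ends and an edge of `A` the outer ones; no other vertices of
    -- the arcs lie in these cliques, so there is no chord.
    opposite-even : ∀ {s₁ ℓ₁ s₂ ℓ₂} → Bridge A B s₁ ℓ₁ → Bridge B A s₂ ℓ₂ →
      s₁ + ℓ₁ < s₂ → s₂ + ℓ₂ < s₁ + n → 4 ≤ suc ℓ₁ + suc ℓ₂ → parity (suc ℓ₁ + suc ℓ₂) ≡ 0ℙ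
    opposite-even {s₁} {ℓ₁} {s₂} {ℓ₂} b₁ b₂ e₁<s₂ e₂<s₁+n 4≤ = even-parallel 4≤ B₁.free (λ x<y y≤ → B₂.free x<y y≤ ∘ flip) ends
      (keep-right {A} {B} B-ins B₁.end B₂.start′ (apart ≤-refl z≤n))
      (keep-left {A} {B} A-ins B₁.start′ B₂.end (apart z≤n ≤-refl))
      where
      module B₁ = Bridge b₁
      module B₂ = Bridge b₂
      open Holes {A} {B} A-ins
      open TwoIntervals {s₁} {ℓ₁} {s₂} {ℓ₂} e₁<s₂ e₂<s₁+n
      ends : ∀ {x y} → x ≤ ℓ₁ → y ≤ ℓ₂ → InA∪InB A B (V (s₁ + x)) (V (s₂ + y)) → Ends ℓ₁ ℓ₂ x y
      ends x≤ y≤ (inj₁ (x∈A , y∈A)) = inj₂ (B₁.only-A x≤ x∈A , B₂.only-B y≤ y∈A)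
      ends x≤ y≤ (inj₂ (x∈B , y∈B)) = inj₁ (B₁.only-B x≤ x∈B , B₂.only-A y≤ y∈B)

    same-even : ∀ {s₁ ℓ₁ s₂ ℓ₂} → Bridge A B s₁ ℓ₁ → Bridge A B s₂ ℓ₂ →
      s₁ + ℓ₁ < s₂ → s₂ + ℓ₂ < s₁ + n → suc (s₁ + ℓ₁) ≢ s₂ → suc (s₂ + ℓ₂) ≢ s₁ + n →
      4 ≤ suc ℓ₁ + suc ℓ₂ → parity (suc ℓ₁ + suc ℓ₂) ≡ 0ℙ
    same-even {s₁} {ℓ₁} {s₂} {ℓ₂} b₁ b₂ e₁<s₂ e₂<s₁+n no-link₁ no-link₂ 4≤ =
      even-crossed 4≤ no-link₁ no-link₂ B₁.free B₂.free ends
      (keep-right {A} {B} B-ins B₁.end B₂.end (apart ≤-refl ≤-refl))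
      (keep-left {A} {B} A-ins B₁.start′ B₂.start′ (apart z≤n z≤n))
      where
      module B₁ = Bridge b₁
      module B₂ = Bridge b₂
      open Holes {A} {B} A-ins
      open TwoIntervals {s₁} {ℓ₁} {s₂} {ℓ₂} e₁<s₂ e₂<s₁+n
      ends : ∀ {x y} → x ≤ ℓ₁ → y ≤ ℓ₂ → InA∪InB A B (V (s₁ + x)) (V (s₂ + y)) → Ends ℓ₁ ℓ₂ x (ℓ₂ ∸ y)
      ends x≤ y≤ (inj₁ (x∈A , y∈A)) = inj₂ (B₁.only-A x≤ x∈A , cong (ℓ₂ ∸_) (B₂.only-A y≤ y∈A))
      ends x≤ y≤ (inj₂ (x∈B , y∈B)) = inj₁ (B₁.only-B x≤ x∈B , trans (cong (ℓ₂ ∸_) (B₂.only-B y≤ y∈B)) (n∸n≡0 ℓ₂))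

  -- The sum of the parities of its two ends is the parity of an arc's length.
  lengths-agree : ∀ s₁ ℓ₁ s₂ ℓ₂ → parity (suc ℓ₁ + suc ℓ₂) ≡ 0ℙ →
    parity s₁ ℙ.+ parity (s₁ + ℓ₁) ≡ parity s₂ ℙ.+ parity (s₂ + ℓ₂)
  lengths-agree s₁ ℓ₁ s₂ ℓ₂ even = trans (length s₁ ℓ₁) (trans agree (sym (length s₂ ℓ₂)))
    where
    p+p+q≡q : ∀ p q → p ℙ.+ (p ℙ.+ q) ≡ q
    p+p+q≡q 0ℙ q = refl
    p+p+q≡q 1ℙ q = ℙ.⁻¹-involutive q
    length : ∀ s ℓ → parity s ℙ.+ parity (s + ℓ) ≡ parity ℓ
    length s ℓ = trans (cong (parity s ℙ.+_) (ℙ.+-homo-+ s ℓ)) (p+p+q≡q (parity s) (parity ℓ))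
    p+q≡0⇒p≡q : ∀ p q → p ℙ.+ q ≡ 0ℙ → p ≡ q
    p+q≡0⇒p≡q 0ℙ q  eq = sym eq
    p+q≡0⇒p≡q 1ℙ 1ℙ eq = refl
    agree : parity ℓ₁ ≡ parity ℓ₂
    agree = p+q≡0⇒p≡q _ _ (trans (sym (ℙ.+-homo-+ ℓ₁ ℓ₂)) (trans (cong (parity ∘ suc) (sym (+-suc ℓ₁ ℓ₂))) even))

  none-shift : ∀ {A s e} → None (Mark A) s e → None (Mark A) (s + n) (e + n)
  none-shift {A} {s} {e} none {y} s+n<y y<e+n Vy∈A
    with d , refl ← m≤n⇒∃[o]m+o≡n (≤-trans (m≤n+m n s) (<⇒≤ s+n<y)) =
    none (+-cancelʳ-< n s d (subst (s + n <_) (+-comm n d) s+n<y))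
         (+-cancelʳ-< n d e (subst (_< e + n) (+-comm n d) y<e+n))
         (mark⁻ {A} {d} (subst (Mark A) (+-comm n d) Vy∈A))

  module _ {A B : Subset n} (apart : ∀ {u} → u ∈ A → u ∈ B → ⊥) where

    arc⇒bridge : ∀ {s ℓ} → Arc (Mark A) (Mark B) s (s + ℓ) → 1 ≤ ℓ × Bridge A B s ℓ
    arc⇒bridge {s} {ℓ} a = 1≤ℓ , record { start = start ; end = end ; only-A = only-A ; only-B = only-B }
      where
      open Arc a
      1≤ℓ : 1 ≤ ℓ
      1≤ℓ = +-cancelˡ-< s 0 ℓ (subst (_< s + ℓ) (sym (+-identityʳ s)) s<e)
      only-A : ∀ {x} → x ≤ ℓ → Mark A (s + x) → x ≡ 0
      only-A {zero}  _   _   = refl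
      only-A {suc x} x≤ℓ x∈A with m≤n⇒m<n∨m≡n x≤ℓ
      ... | inj₁ x<ℓ  = contradiction x∈A (noneˢ (m<m+n s z<s) (+-monoʳ-< s x<ℓ))
      ... | inj₂ refl = ⊥-elim (apart x∈A end)
      only-B : ∀ {x} → x ≤ ℓ → Mark B (s + x) → x ≡ ℓ
      only-B {x} x≤ℓ x∈B with m≤n⇒m<n∨m≡n x≤ℓ
      only-B {x}     x≤ℓ x∈B | inj₂ x≡ℓ = x≡ℓ
      only-B {zero}  x≤ℓ x∈B | inj₁ x<ℓ = ⊥-elim (apart start (subst (Mark B) (+-identityʳ s) x∈B))
      only-B {suc x} x≤ℓ x∈B | inj₁ x<ℓ = contradiction x∈B (noneᵉ (m<m+n s z<s) (+-monoʳ-< s x<ℓ))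

    arc-shift : ∀ {s e} → Arc (Mark A) (Mark B) s e → Arc (Mark A) (Mark B) (s + n) (e + n)
    arc-shift {s} {e} a = record
      { s<e = +-monoˡ-< n s<e ; start = mark⁺ {A} {s} start ; end = mark⁺ {B} {e} end
      ; noneˢ = none-shift {A} {s} {e} noneˢ ; noneᵉ = none-shift {B} {s} {e} noneᵉ }
      where open Arc a

  4≤ : ∀ {ℓ₁ ℓ₂} → 1 ≤ ℓ₁ → 1 ≤ ℓ₂ → 4 ≤ suc ℓ₁ + suc ℓ₂
  4≤ 1≤ℓ₁ 1≤ℓ₂ = +-mono-≤ (s≤s 1≤ℓ₁) (s≤s 1≤ℓ₂)

  module _ {A B : Subset n} (A-ins : Inscribed G A) (B-ins : Inscribed G B)
    (apart : ∀ {u} → u ∈ A → u ∈ B → ⊥) where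

    opposite-arcs : ∀ {s e s′ e′} → Arc (Mark A) (Mark B) s e → Arc (Mark B) (Mark A) s′ e′ →
      e < s′ → e′ < s + n → parity s ℙ.+ parity e ≡ parity s′ ℙ.+ parity e′
    opposite-arcs {s} {_} {s′} a a′ e<s′ e′<s+n
      with ℓ , refl ← m≤n⇒∃[o]m+o≡n (<⇒≤ (Arc.s<e a)) | ℓ′ , refl ← m≤n⇒∃[o]m+o≡n (<⇒≤ (Arc.s<e a′))
      with 1≤ℓ , b ← arc⇒bridge apart {s} {ℓ} a | 1≤ℓ′ , b′ ← arc⇒bridge (λ u∈B u∈A → apart u∈A u∈B) {s′} {ℓ′} a′ =
      lengths-agree s ℓ s′ ℓ′ (opposite-even A-ins B-ins b b′ e<s′ e′<s+n (4≤ 1≤ℓ 1≤ℓ′))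

    -- Adjoining arcs need no hole: `s`, `s′` bound a gap of `A` and `e`, `e′` a gap of `B`. Both
    -- gaps are odd and exceed an arc by one step, so both arcs are even.
    linked-arcs : ∀ {s e s′ e′} → Arc (Mark A) (Mark B) s e → Arc (Mark A) (Mark B) s′ e′ →
      suc e ≡ s′ → parity s ℙ.+ parity e ≡ parity s′ ℙ.+ parity e′
    linked-arcs {s} {e} {_} {e′} a a′ refl = solve (parity s) _ _ _
        (ℙ.suc-homo-⁻¹ e) (odd-gaps A-ins (<-trans F.s<e (n<1+n e)) F.start S.start none-A)
        (odd-gaps B-ins (<-trans (n<1+n e) S.s<e) F.end S.end none-B)
      where
      module F = Arc a
      module S = Arc a′
      none-A : None (Mark A) s (suc e)
      none-A s<y y<1+e y∈A with m≤n⇒m<n∨m≡n (s≤s⁻¹ y<1+e)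
      ... | inj₁ y<e  = F.noneˢ s<y y<e y∈A
      ... | inj₂ refl = apart y∈A F.end
      none-B : None (Mark B) e e′
      none-B e<y y<e′ y∈B with m≤n⇒m<n∨m≡n e<y
      ... | inj₁ 1+e<y = S.noneᵉ 1+e<y y<e′ y∈B
      ... | inj₂ refl  = apart S.start y∈B
      solve : ∀ s e s′ e′ → s′ ⁻¹ ≡ e → s′ ≡ s ⁻¹ → e′ ≡ e ⁻¹ → s ℙ.+ e ≡ s′ ℙ.+ e′
      solve 0ℙ _ _ _ refl refl refl = refl
      solve 1ℙ _ _ _ refl refl refl = refl

    same-arcs : ∀ {s e s′ e′} → Arc (Mark A) (Mark B) s e → Arc (Mark A) (Mark B) s′ e′ →
      e < s′ → e′ < s + n → parity s ℙ.+ parity e ≡ parity s′ ℙ.+ parity e′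
    same-arcs {s} {e} {s′} {e′} a a′ e<s′ e′<s+n with suc e ≟ s′ | suc e′ ≟ s + n
    ... | yes link | _        = linked-arcs a a′ link
    -- The arcs adjoin across the start of the turn, so the first one is moved forward by a full
    -- turn.
    ... | no _     | yes link = sym (trans (linked-arcs a′ (arc-shift apart a) link)
      (trans (cong₂ ℙ._+_ (parity-+n n-odd s) (parity-+n n-odd e)) (⁻¹-+-⁻¹ (parity s) (parity e))))
    ... | no no-link₁ | no no-link₂
      with ℓ , refl ← m≤n⇒∃[o]m+o≡n (<⇒≤ (Arc.s<e a)) | ℓ′ , refl ← m≤n⇒∃[o]m+o≡n (<⇒≤ (Arc.s<e a′))
      with 1≤ℓ , b ← arc⇒bridge apart {s} {ℓ} a | 1≤ℓ′ , b′ ← arc⇒bridge apart {s′} {ℓ′} a′ =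
      lengths-agree s ℓ s′ ℓ′ (same-even A-ins B-ins b b′ e<s′ e′<s+n no-link₁ no-link₂ (4≤ 1≤ℓ 1≤ℓ′))

  -- The common vertex of the inscribed cliques

  inscribed-meet : ∀ {A B} → Inscribed G A → Inscribed G B → ∃ λ u → u ∈ A × u ∈ B
  inscribed-meet {A} {B} A-ins B-ins with any? (λ u → (u ∈? A) ×-dec (u ∈? B))
  ... | yes hit = hit
  ... | no miss with x , _ , Vx∈A ← someMark A-ins 0 =
    ⊥-elim (TwoColours.unmarked {n} n-odd (mark? A) (mark? B)
      (λ {t} → mark⁺ {A} {t}) (λ {t} → mark⁺ {B} {t}) (λ {t} → mark⁻ {B} {t})
      (odd-gaps A-ins) (odd-gaps B-ins) apart (someMark B-ins)
      (λ {s} → otherMark {s = s} A-ins) (λ {s} → otherMark {s = s} B-ins)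
      (opposite-arcs A-ins B-ins apart) (same-arcs A-ins B-ins apart)
      (same-arcs B-ins A-ins (λ u∈B u∈A → apart u∈A u∈B)) {x} Vx∈A)
    where
    apart : ∀ {u} → u ∈ A → u ∈ B → ⊥
    apart u∈A u∈B = miss (_ , u∈A , u∈B)

  meet-unique : ∀ {A B u v} → Inscribed G A → Inscribed G B → A ≢ B →
    u ∈ A → u ∈ B → v ∈ A → v ∈ B → u ≡ v
  meet-unique {u = u} {v} (A-max , _) (B-max , _) A≢B u∈A u∈B v∈A v∈B =
    decidable-stable (u Fin.≟ v) λ u≢v →
      A≢B (maxClique-unique diamondFree A-max B-max u≢v u∈A v∈A u∈B v∈B)

  -- If ξ ∉ C, then ξ, A ∩ C and B ∩ C span a triangle, which forces ξ into the clique C after all.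
  meet-common : ∀ {A B C ξ} → Inscribed G A → Inscribed G B → Inscribed G C → A ≢ B →
    ξ ∈ A → ξ ∈ B → ξ ∈ C
  meet-common {C = C} {ξ} A-ins B-ins C-ins A≢B ξ∈A ξ∈B with ξ ∈? C
  ... | yes ξ∈C = ξ∈C
  ... | no ξ∉C with z , z∈A , z∈C ← inscribed-meet A-ins C-ins
               with y , y∈B , y∈C ← inscribed-meet B-ins C-ins =
    maxClique-absorbs diamondFree (proj₁ C-ins) z∈C y∈C
      (λ { refl → ξ≢z (meet-unique A-ins B-ins A≢B ξ∈A ξ∈B z∈A y∈B) })
      (proj₁ (proj₁ A-ins) ξ z ξ∈A z∈A ξ≢z)
      (proj₁ (proj₁ B-ins) ξ y ξ∈B y∈B (λ { refl → ξ∉C y∈C }))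
    where
    ξ≢z : ξ ≢ z
    ξ≢z refl = ξ∉C z∈C

  common-vertex : ∃ λ ξ → ∀ K → Inscribed G K → ξ ∈ K
  common-vertex with anySubset? inscribed?
  -- Without inscribed cliques any vertex serves; with a single one, any of its vertices does.
  ... | no none = zero , λ K K-ins → contradiction (K , K-ins) none
  ... | yes (A , A-ins) with anySubset? (λ K → inscribed? K ×-dec ¬? (K ≟ˢ A))
  ...   | no only-A with ξ , ξ∈A ← maxClique-nonempty zero (proj₁ A-ins) =
    ξ , λ K K-ins → subst (ξ ∈_) (sym (decidable-stable (K ≟ˢ A) λ K≢A → only-A (K , K-ins , K≢A))) ξ∈A
  ...   | yes (B , B-ins , B≢A) with ξ , ξ∈A , ξ∈B ← inscribed-meet A-ins B-ins =
    ξ , λ K K-ins → meet-common A-ins B-ins K-ins (B≢A ∘ sym) ξ∈A ξ∈B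

  module _ {ξ : Fin n} (common : ∀ K → Inscribed G K → ξ ∈ K) where

    n3 : N3 G ξ
    n3 = common , λ A B A-ins B-ins A≢B v v∈A v∈B →
      meet-unique A-ins B-ins A≢B v∈A v∈B (common A A-ins) (common B B-ins)

    -- As `ξ` lies in `A`, these are `A`-paths.
    n4 : N4 G σ ξ
    n4 A A-ins i m (2≤m , m≤n , ends , none) = proj₁ (n1 A A-ins i m (2≤m , m≤n , inj₁ (both ends) , none))
      where
      both : ∀ {u v} → (u ∈ A × v ≡ ξ) ⊎ (u ≡ ξ × v ∈ A) → u ∈ A × v ∈ A
      both (inj₁ (u∈A , refl)) = u∈A , common A A-ins
      both (inj₂ (refl , v∈A)) = common A A-ins , v∈A

    -- The vertex `ξ` is adjacent to both ends and closes the bridge to a hole with one vertex more.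
    odd-bridge : ∀ {A B s ℓ} → Inscribed G A → Inscribed G B → Bridge A B s (suc ℓ) → s + suc ℓ < s + n →
      (∀ {x} → x ≤ suc ℓ → V (s + x) ≢ ξ) → Odd (suc (suc ℓ))
    odd-bridge {A} {B} {s} {ℓ} A-ins B-ins b e<s+n avoid with p , s≤p , p<s+n , Vp≡ξ ← V-onto s ξ =
      parity⇒odd (suc (suc ℓ)) (solve _ (trans (sym (ℙ.+-homo-+ (suc (suc ℓ)) 1))
        (opposite-even A-ins B-ins b hub e<p (subst (_< s + n) (sym (+-identityʳ p)) p<s+n) (long ℓ b avoid))))
      where
      ξ∈A : ξ ∈ A
      ξ∈A = common A A-ins
      ξ∈B : ξ ∈ B
      ξ∈B = common B B-ins
      -- A bridge of length zero, since `ξ` belongs to both cliques.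
      hub : Bridge B A p 0
      hub = record { start = subst (_∈ B) (sym Vp≡ξ) ξ∈B
                   ; end = subst (_∈ A) (sym (trans (cong V (+-identityʳ p)) Vp≡ξ)) ξ∈A
                   ; only-A = λ x≤0 _ → n≤0⇒n≡0 x≤0 ; only-B = λ x≤0 _ → n≤0⇒n≡0 x≤0 }
      e<p : s + suc ℓ < p
      e<p = ≰⇒> λ p≤e → before s≤p p≤e Vp≡ξ
        where
        before : ∀ {p} → s ≤ p → p ≤ s + suc ℓ → V p ≢ ξ
        before s≤p p≤e with d , refl ← m≤n⇒∃[o]m+o≡n s≤p = avoid (+-cancelˡ-≤ s d (suc ℓ) p≤e)
      long : ∀ ℓ → Bridge A B s (suc ℓ) → (∀ {x} → x ≤ suc ℓ → V (s + x) ≢ ξ) → 4 ≤ suc (suc ℓ) + 1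
      long (suc ℓ) _ _ = s≤s (s≤s (s≤s (≤-trans (s≤s z≤n) (m≤n+m 1 ℓ))))
      -- A bridge that is a single rim edge would form a triangle with `ξ`.
      long zero b avoid = ⊥-elim (no-rim-triangle
        (subst (λ x → RimAdj σ (V s) (V x)) (+-comm 1 s) (rim-suc s))
        (proj₁ (proj₁ A-ins) ξ _ ξ∈A (Bridge.start b)
          (subst (λ x → ξ ≢ V x) (+-identityʳ s) (avoid {0} z≤n ∘ sym)))
        (proj₁ (proj₁ B-ins) ξ _ ξ∈B (Bridge.end b) (avoid {1} ≤-refl ∘ sym)))
      solve : ∀ p → p ℙ.+ 1ℙ ≡ 0ℙ → p ≡ 1ℙ
      solve 1ℙ _ = refl

    -- Interior vertices lie in no inscribed clique, and an end in both `A` and `B` would be `ξ`;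
    -- hence the path is a bridge that avoids `ξ`.
    path-odd : ∀ {A B} → Inscribed G A → Inscribed G B → A ≢ B → ∀ i ℓ → suc (suc ℓ) ≤ n →
      rv σ i 0 ∈ A → rv σ i (suc ℓ) ∈ B → NoInscribedInterior G σ i (suc (suc ℓ)) →
      rv σ i 0 ≢ ξ → rv σ i (suc ℓ) ≢ ξ → Odd (suc (suc ℓ))
    path-odd {A} {B} A-ins B-ins A≢B i ℓ m≤n 0∈A e∈B none 0≢ξ e≢ξ = odd-bridge A-ins B-ins bridge (+-monoʳ-< s m≤n) avoid
      where
      s : ℕ
      s = toℕ i
      at : ∀ {K t} → rv σ i t ∈ K → Mark K (s + t)
      at {K} = subst (_∈ K) (rv≡V i _)
      at⁻ : ∀ {K t} → Mark K (s + t) → rv σ i t ∈ K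
      at⁻ {K} = subst (_∈ K) (sym (rv≡V i _))
      common-only : ∀ {t} → Mark A (s + t) → Mark B (s + t) → V (s + t) ≡ ξ
      common-only t∈A t∈B = proj₂ n3 A B A-ins B-ins A≢B _ t∈A t∈B
      avoid : ∀ {x} → x ≤ suc ℓ → V (s + x) ≢ ξ
      avoid {x} x≤ eq with m≤n⇒m<n∨m≡n x≤
      avoid {zero}  x≤ eq | inj₁ _    = 0≢ξ (trans (rv≡V i 0) eq)
      avoid {suc x} x≤ eq | inj₁ x<   = none (suc x) z<s (s≤s x<) A A-ins
        (at⁻ (subst (_∈ A) (sym eq) (common A A-ins)))
      avoid         x≤ eq | inj₂ refl = e≢ξ (trans (rv≡V i (suc ℓ)) eq)
      bridge : Bridge A B s (suc ℓ)
      bridge = record { start = subst (Mark A) (+-identityʳ s) (at 0∈A) ; end = at e∈B ; only-A = only-A ; only-B = only-B }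
        where
        only-A : ∀ {x} → x ≤ suc ℓ → Mark A (s + x) → x ≡ 0
        only-A {zero} _ _ = refl
        only-A {suc x} x≤ x∈A with m≤n⇒m<n∨m≡n x≤
        ... | inj₁ x<   = contradiction (at⁻ x∈A) (none (suc x) z<s (s≤s x<) A A-ins)
        ... | inj₂ refl = contradiction (common-only x∈A (at e∈B)) (avoid ≤-refl)
        only-B : ∀ {x} → x ≤ suc ℓ → Mark B (s + x) → x ≡ suc ℓ
        only-B {x} x≤ x∈B with m≤n⇒m<n∨m≡n x≤
        only-B {x}     x≤ x∈B | inj₂ x≡ = x≡
        only-B {zero}  x≤ x∈B | inj₁ _  = contradiction (common-only (at 0∈A) x∈B) (avoid z≤n)
        only-B {suc x} x≤ x∈B | inj₁ x< = contradiction (at⁻ x∈B) (none (suc x) z<s (s≤s x<) B B-ins)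

    n5 : N5 G σ ξ
    n5 A B A-ins B-ins A≢B i (suc zero) (s≤s () , _)
    n5 A B A-ins B-ins A≢B i (suc (suc ℓ)) (_ , m≤n , inj₁ (0∈A , e∈B) , none) =
      path-odd A-ins B-ins A≢B i ℓ m≤n 0∈A e∈B none
    n5 A B A-ins B-ins A≢B i (suc (suc ℓ)) (_ , m≤n , inj₂ (0∈B , e∈A) , none) =
      path-odd B-ins A-ins (A≢B ∘ sym) i ℓ m≤n 0∈B e∈A none

  nConditions : NConditions G σ
  nConditions with ξ , common ← common-vertex =
    n1 , (λ A A-ins → odd-size A-ins) , ξ , n3 common , n4 common , n5 common

theorem2 : ∀ {n : ℕ} (G : Graph n) (σ : Fin n → Fin n) →
    IsMultisun G σ → HOHFree G → NConditions G σ
theorem2 {zero}  G σ ms hoh = contradiction (IsMultisun.atLeast3 ms) λ ()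
theorem2 {suc n} G σ ms hoh = HOHFreeMultisun.nConditions ms hoh
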